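{- Let $G$ be a finite simple undirected connected graph, and let $c:V(G)\to \mathbb{R}_{>0}$ and $\kappa:V(G)\to \mathbb{Z}$ be functions such that $0\leq \kappa(u)\leq d_G(u)$ for every vertex $u$ of $G$. Then $$\beta(G,c,\kappa) = \sum_{u\in V(G)} \frac{c(u)\big(d_G(u)-\kappa(u)\big)\big(d_G(u)-\kappa(u)+1\big)}{2(d_G(u)+1)}$$ holds if and only if one of the following holds: (i) $\kappa(u)=d_G(u)$ for every vertex $u$ of $G$; (ii) $c$ is constant on $V(G)$ and $\kappa(u)=0$ for every vertex $u$ of $G$; (iii) $G$ is a clique (complete graph), $c$ and $\kappa$ are constant on $V(G)$, and $0<\kappa(u)<d_G(u)$ for every vertex $u$ of $G$.
   Context: $d_G(u)$ denotes the degree of $u$ in $G$, and $[n]=\{1,\dots,n\}$. For a function $\lambda:V(G)\to\mathbb{Z}$, a set $I\subseteq V(G)$ is called $\lambda$-degenerate in $G$ if there is a linear ordering $u_1,\ldots,u_k$ of the vertices of $I$ such that for every $i\in[k]$, $u_i$ has at most $\lambda(u_i)$ neighbors in $\{u_j: j\in[i-1]\}$. Define $$\beta(G,c,\kappa)=\min\Big\{\sum_{u\in V(G)} c(u)\iota(u) : \iota:V(G)\to\mathbb{Z}_{\geq 0} \text{ and } V(G) \text{ is } (\kappa+\iota)\text{ -degenerate in } G\Big\}.$$ (It is known that always $\beta(G,c,\kappa)$ is at most the right-hand side sum in the claim.) -}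

module Defs where

open import Algebra.Bundles using (CommutativeMonoid; CommutativeSemigroup)
open import Algebra.Properties.CommutativeSemigroup using (interchange)
open import Data.Fin using (Fin; toℕ)
open import Data.Fin.Subset using (Subset; ⊤) renaming (_∈_ to _∈ₛ_)
open import Data.Integer using (ℤ; +_)
import Data.Integer as ℤ
open import Data.List using (List; length; filter; allFin; take; lookup)
open import Data.List.Membership.Propositional using (_∈_)
open import Data.List.Relation.Unary.Unique.Propositional using (Unique)
open import Data.Nat using (ℕ; suc; _⊔_)
import Data.Nat as ℕ
import Data.Nat.Properties as ℕ
open import Data.Product using (Σ; ∃; _×_; _,_)
open import Data.Rational using (ℚ; 0ℚ; 1ℚ; ½; ∣_∣)
import Data.Rational as ℚ
import Data.Rational.Properties as ℚ
import Data.Vec.Functional as Vector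
open import Function.Bundles using (_⇔_)
open import Level using (0ℓ)
open import Relation.Binary.Construct.Closure.ReflexiveTransitive using (Star)
open import Relation.Binary.Core using (Rel)
open import Relation.Binary.Definitions using (Symmetric; Irreflexive; Decidable)
open import Relation.Binary.PropositionalEquality using (_≡_; _≢_; sym; trans; cong; cong₂; subst)

------------------------------------------------------------------------
-- Real numbers: Cauchy sequences of rationals (carrying a modulus),
-- considered up to _≈_.

IsCauchy : (ℕ → ℚ) → Set
IsCauchy x = ∀ ε → 0ℚ ℚ.< ε →
  ∃ λ N → ∀ m n → N ℕ.≤ m → N ℕ.≤ n → ∣ x m ℚ.- x n ∣ ℚ.≤ ε

record ℝ : Set where
  constructor mkℝ
  field
    seq    : ℕ → ℚ
    cauchy : IsCauchy seq

open ℝ public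

infix 4 _≈_ _≤_ _<_

_≈_ : Rel ℝ 0ℓ
x ≈ y = ∀ ε → 0ℚ ℚ.< ε →
  ∃ λ N → ∀ n → N ℕ.≤ n → ∣ seq x n ℚ.- seq y n ∣ ℚ.≤ ε

_≤_ : Rel ℝ 0ℓ
x ≤ y = ∀ ε → 0ℚ ℚ.< ε →
  ∃ λ N → ∀ n → N ℕ.≤ n → seq x n ℚ.≤ seq y n ℚ.+ ε

_<_ : Rel ℝ 0ℓ
x < y = ∃ λ ε → 0ℚ ℚ.< ε ×
  ∃ λ N → ∀ n → N ℕ.≤ n → seq x n ℚ.+ ε ℚ.≤ seq y n

fromℚ : ℚ → ℝ
fromℚ q = mkℝ (λ _ → q) λ ε 0<ε → 0 , λ _ _ _ _ →
  subst (ℚ._≤ ε) (sym (cong ∣_∣ (ℚ.+-inverseʳ q))) (ℚ.<⇒≤ 0<ε)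

0ℝ : ℝ
0ℝ = fromℚ 0ℚ

fromℕ : ℕ → ℝ
fromℕ n = fromℚ (+ n ℚ./ 1)

private

  +-commutativeSemigroup : CommutativeSemigroup 0ℓ 0ℓ
  +-commutativeSemigroup = CommutativeMonoid.commutativeSemigroup ℚ.+-0-commutativeMonoid

  *-distribˡ-- : ∀ a b c → a ℚ.* (b ℚ.- c) ≡ a ℚ.* b ℚ.- a ℚ.* c
  *-distribˡ-- a b c = trans (ℚ.*-distribˡ-+ a b (ℚ.- c))
    (cong (a ℚ.* b ℚ.+_) (sym (ℚ.neg-distribʳ-* a c)))

  telescope : ∀ a b c → (a ℚ.- b) ℚ.+ (b ℚ.- c) ≡ a ℚ.- c
  telescope a b c = trans (ℚ.+-assoc a (ℚ.- b) (b ℚ.- c)) (cong (a ℚ.+_)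
    (trans (sym (ℚ.+-assoc (ℚ.- b) b (ℚ.- c)))
      (trans (cong (ℚ._+ ℚ.- c) (ℚ.+-inverseˡ b)) (ℚ.+-identityˡ (ℚ.- c)))))

  0<½* : ∀ {ε} → 0ℚ ℚ.< ε → 0ℚ ℚ.< ½ ℚ.* ε
  0<½* {ε} 0<ε = ℚ.*-monoʳ-<-pos ½ 0<ε

  ½+½ : ∀ ε → ½ ℚ.* ε ℚ.+ ½ ℚ.* ε ≡ ε
  ½+½ ε = trans (sym (ℚ.*-distribʳ-+ ε ½ ½)) (ℚ.*-identityˡ ε)

  +-cauchy : ∀ {x y} → IsCauchy x → IsCauchy y → IsCauchy (λ n → x n ℚ.+ y n)
  +-cauchy {x} {y} cx cy ε 0<ε
    with cx (½ ℚ.* ε) (0<½* 0<ε) | cy (½ ℚ.* ε) (0<½* 0<ε)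
  ... | M , px | N , py = M ⊔ N , λ m n m≥ n≥ → begin
    ∣ (x m ℚ.+ y m) ℚ.- (x n ℚ.+ y n) ∣
      ≡⟨ cong ∣_∣ (rearrange (x m) (y m) (x n) (y n)) ⟩
    ∣ (x m ℚ.- x n) ℚ.+ (y m ℚ.- y n) ∣
      ≤⟨ ℚ.∣p+q∣≤∣p∣+∣q∣ (x m ℚ.- x n) (y m ℚ.- y n) ⟩
    ∣ x m ℚ.- x n ∣ ℚ.+ ∣ y m ℚ.- y n ∣
      ≤⟨ ℚ.+-mono-≤ (px m n (ℕ.m⊔n≤o⇒m≤o M N m≥) (ℕ.m⊔n≤o⇒m≤o M N n≥))
                    (py m n (ℕ.m⊔n≤o⇒n≤o M N m≥) (ℕ.m⊔n≤o⇒n≤o M N n≥)) ⟩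
    ½ ℚ.* ε ℚ.+ ½ ℚ.* ε
      ≡⟨ ½+½ ε ⟩
    ε ∎
    where
    open ℚ.≤-Reasoning
    rearrange : ∀ a b c d → (a ℚ.+ b) ℚ.- (c ℚ.+ d) ≡ (a ℚ.- c) ℚ.+ (b ℚ.- d)
    rearrange a b c d = trans (cong (a ℚ.+ b ℚ.+_) (ℚ.neg-distrib-+ c d))
      (interchange +-commutativeSemigroup a b (ℚ.- c) (ℚ.- d))

  EventuallyBounded : (ℕ → ℚ) → Set
  EventuallyBounded x = ∃ λ K → ℚ.Positive K × ∃ λ N → ∀ n → N ℕ.≤ n → ∣ x n ∣ ℚ.≤ K

  bounded : ∀ {x} → IsCauchy x → EventuallyBounded x
  bounded {x} cx with cx 1ℚ (ℚ.positive⁻¹ 1ℚ)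
  ... | N , p = 1ℚ ℚ.+ ∣ x N ∣
              , ℚ.positive (ℚ.+-mono-<-≤ (ℚ.positive⁻¹ 1ℚ) (ℚ.0≤∣p∣ (x N)))
              , N , λ n n≥ → begin
    ∣ x n ∣                        ≡⟨ cong ∣_∣ (split (x n) (x N)) ⟩
    ∣ (x n ℚ.- x N) ℚ.+ x N ∣      ≤⟨ ℚ.∣p+q∣≤∣p∣+∣q∣ (x n ℚ.- x N) (x N) ⟩
    ∣ x n ℚ.- x N ∣ ℚ.+ ∣ x N ∣    ≤⟨ ℚ.+-monoˡ-≤ ∣ x N ∣ (p n N n≥ ℕ.≤-refl) ⟩
    1ℚ ℚ.+ ∣ x N ∣                 ∎
    where
    open ℚ.≤-Reasoning
    split : ∀ a b → a ≡ (a ℚ.- b) ℚ.+ b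
    split a b = sym (trans (ℚ.+-assoc a (ℚ.- b) b)
      (trans (cong (a ℚ.+_) (ℚ.+-inverseˡ b)) (ℚ.+-identityʳ a)))

  scaled : ∀ K → ℚ.Positive K → ∀ ε → 0ℚ ℚ.< ε →
           ∃ λ δ → 0ℚ ℚ.< δ × K ℚ.* δ ≡ ε
  scaled K K>0 ε 0<ε = 1/K ℚ.* ε , 0<δ , Kδ≡ε
    where
    instance
      _ = K>0
      _ = ℚ.pos⇒nonZero K
    1/K = ℚ.1/ K
    0<δ : 0ℚ ℚ.< 1/K ℚ.* ε
    0<δ = subst (ℚ._< 1/K ℚ.* ε) (ℚ.*-zeroʳ 1/K)
            (ℚ.*-monoʳ-<-pos 1/K {{ℚ.1/pos⇒pos K}} 0<ε)
    Kδ≡ε : K ℚ.* (1/K ℚ.* ε) ≡ ε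
    Kδ≡ε = trans (sym (ℚ.*-assoc K 1/K ε))
             (trans (cong (ℚ._* ε) (ℚ.*-inverseʳ K)) (ℚ.*-identityˡ ε))

  ∣*∣-mono-≤ : ∀ p q {K δ} → ℚ.Positive K → ∣ p ∣ ℚ.≤ K → ∣ q ∣ ℚ.≤ δ →
               ∣ p ℚ.* q ∣ ℚ.≤ K ℚ.* δ
  ∣*∣-mono-≤ p q {K} {δ} K>0 p≤K q≤δ = begin
    ∣ p ℚ.* q ∣       ≡⟨ ℚ.∣p*q∣≡∣p∣*∣q∣ p q ⟩
    ∣ p ∣ ℚ.* ∣ q ∣   ≤⟨ ℚ.*-monoʳ-≤-nonNeg ∣ q ∣ {{ℚ.∣-∣-nonNeg q}} p≤K ⟩
    K ℚ.* ∣ q ∣       ≤⟨ ℚ.*-monoˡ-≤-nonNeg K {{ℚ.pos⇒nonNeg K {{K>0}}}} q≤δ ⟩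
    K ℚ.* δ           ∎
    where open ℚ.≤-Reasoning

  *-cauchy : ∀ {x y} → IsCauchy x → IsCauchy y → IsCauchy (λ n → x n ℚ.* y n)
  *-cauchy {x} {y} cx cy ε 0<ε
    with bounded {x} cx | bounded {y} cy
  ... | K , K>0 , A , bx | L , L>0 , B , by
    with scaled K K>0 (½ ℚ.* ε) (0<½* 0<ε) | scaled L L>0 (½ ℚ.* ε) (0<½* 0<ε)
  ... | δ , 0<δ , Kδ | η , 0<η , Lη
    with cy δ 0<δ | cx η 0<η
  ... | M , py | N , px = (A ⊔ B) ⊔ (M ⊔ N) , λ m n m≥ n≥ →
    let m≥AB = ℕ.m⊔n≤o⇒m≤o (A ⊔ B) (M ⊔ N) m≥
        n≥AB = ℕ.m⊔n≤o⇒m≤o (A ⊔ B) (M ⊔ N) n≥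
        m≥MN = ℕ.m⊔n≤o⇒n≤o (A ⊔ B) (M ⊔ N) m≥
        n≥MN = ℕ.m⊔n≤o⇒n≤o (A ⊔ B) (M ⊔ N) n≥
    in begin
    ∣ x m ℚ.* y m ℚ.- x n ℚ.* y n ∣
      ≡⟨ cong ∣_∣ (rearrange (x m) (y m) (x n) (y n)) ⟩
    ∣ x m ℚ.* (y m ℚ.- y n) ℚ.+ y n ℚ.* (x m ℚ.- x n) ∣
      ≤⟨ ℚ.∣p+q∣≤∣p∣+∣q∣ (x m ℚ.* (y m ℚ.- y n)) (y n ℚ.* (x m ℚ.- x n)) ⟩
    ∣ x m ℚ.* (y m ℚ.- y n) ∣ ℚ.+ ∣ y n ℚ.* (x m ℚ.- x n) ∣
      ≤⟨ ℚ.+-mono-≤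
           (∣*∣-mono-≤ (x m) (y m ℚ.- y n) K>0 (bx m (ℕ.m⊔n≤o⇒m≤o A B m≥AB))
             (py m n (ℕ.m⊔n≤o⇒m≤o M N m≥MN) (ℕ.m⊔n≤o⇒m≤o M N n≥MN)))
           (∣*∣-mono-≤ (y n) (x m ℚ.- x n) L>0 (by n (ℕ.m⊔n≤o⇒n≤o A B n≥AB))
             (px m n (ℕ.m⊔n≤o⇒n≤o M N m≥MN) (ℕ.m⊔n≤o⇒n≤o M N n≥MN))) ⟩
    K ℚ.* δ ℚ.+ L ℚ.* η
      ≡⟨ cong₂ ℚ._+_ Kδ Lη ⟩
    ½ ℚ.* ε ℚ.+ ½ ℚ.* ε
      ≡⟨ ½+½ ε ⟩
    ε ∎
    where
    open ℚ.≤-Reasoning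
    rearrange : ∀ a b c d →
      a ℚ.* b ℚ.- c ℚ.* d ≡ a ℚ.* (b ℚ.- d) ℚ.+ d ℚ.* (a ℚ.- c)
    rearrange a b c d = sym (trans
      (cong₂ ℚ._+_ (*-distribˡ-- a b d)
        (trans (*-distribˡ-- d a c)
          (cong₂ ℚ._-_ (ℚ.*-comm d a) (ℚ.*-comm d c))))
      (telescope (a ℚ.* b) (a ℚ.* d) (c ℚ.* d)))

infixl 6 _+_
infixl 7 _*_

_+_ : ℝ → ℝ → ℝ
x + y = mkℝ (λ n → seq x n ℚ.+ seq y n) (+-cauchy {seq x} {seq y} (cauchy x) (cauchy y))

_*_ : ℝ → ℝ → ℝ
x * y = mkℝ (λ n → seq x n ℚ.* seq y n) (*-cauchy {seq x} {seq y} (cauchy x) (cauchy y))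

∑ : ∀ {n} → (Fin n → ℝ) → ℝ
∑ = Vector.foldr _+_ 0ℝ

IsMinimum : (ℝ → Set) → ℝ → Set
IsMinimum P m = P m × (∀ x → P x → m ≤ x)

------------------------------------------------------------------------
-- Finite simple graphs on the vertex set Fin n

record Graph (n : ℕ) : Set₁ where
  field
    Adj    : Rel (Fin n) 0ℓ
    adj?   : Decidable Adj
    symm   : Symmetric Adj
    irrefl : Irreflexive _≡_ Adj

module _ {n : ℕ} (G : Graph n) where
  open Graph G

  Connected : Set
  Connected = ∀ u v → Star Adj u v

  IsClique : Set
  IsClique = ∀ u v → u ≢ v → Adj u v

  neighborsIn : Fin n → List (Fin n) → ℕ
  neighborsIn u vs = length (filter (adj? u) vs)

  degree : Fin n → ℕ
  degree u = neighborsIn u (allFin n)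

  -- The witness us = u₁,…,u_k orders I; take (toℕ i) us is the part before
  -- the entry at (zero-based) position i.
  Degenerate : (Fin n → ℤ) → Subset n → Set
  Degenerate l I = Σ (List (Fin n)) λ us →
    Unique us ×
    (∀ v → v ∈ us ⇔ v ∈ₛ I) ×
    (∀ (i : Fin (length us)) →
      + neighborsIn (lookup us i) (take (toℕ i) us) ℤ.≤ l (lookup us i))

  IsCost : (Fin n → ℝ) → (Fin n → ℤ) → ℝ → Set
  IsCost c κ x = Σ (Fin n → ℕ) λ ι →
    Degenerate (λ u → κ u ℤ.+ + ι u) ⊤ ×
    x ≈ ∑ (λ u → c u * fromℕ (ι u))

  -- IsBeta c κ b says β(G,c,κ) = b.  The minimum is given by its graph: constructively, the
  -- comparison of reals needed to select a minimiser is not decidable.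
  IsBeta : (Fin n → ℝ) → (Fin n → ℤ) → ℝ → Set
  IsBeta c κ b = IsMinimum (IsCost c κ) b

  bound : (Fin n → ℝ) → (Fin n → ℤ) → ℝ
  bound c κ = ∑ λ u →
    c u * fromℚ (((+ degree u ℤ.- κ u) ℤ.* (+ degree u ℤ.- κ u ℤ.+ + 1))
                 ℚ./ (2 ℕ.* suc (degree u)))

{-# OPTIONS --safe #-}
module Submission where

-- Let f(π) = ∑ c(u) · max(0, b_π(u) − κ(u)), where b_π(u) counts the neighbors of u that precede
-- it in the ordering π; then β(G,c,κ) is the minimum of f.  Choosing the last vertex uniformly and
-- recursing on the rest shows that the right-hand side of the claim is the average of f over all
-- orderings, so β equals it iff f is constant.  Exchanging two consecutive adjacent vertices u and
-- v that are preceded by the set S, f is constant iff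
--   c(u) · [κ(u) ≤ |N(u) ∩ S|] = c(v) · [κ(v) ≤ |N(v) ∩ S|]
-- for every edge uv and every S avoiding u and v.  For S the set of all other vertices this
-- propagates κ < d along edges and makes c constant; for S a set of κ(v) neighbors of v it makes
-- κ constant and, if κ > 0, forces every neighbor of v to be adjacent to u.

open import Defs
open import Algebra.Bundles using (CommutativeMonoid)
import Algebra.Properties.CommutativeSemigroup as CommutativeSemigroupProperties
import Algebra.Properties.Group as GroupProperties
open import Data.Fin using (Fin; zero; suc; toℕ)
import Data.Fin.Properties as Fin
open import Data.Fin.Subset using (⊤)
open import Data.Fin.Subset.Properties using (∈⊤)
open import Data.Integer using (ℤ; +_)
import Data.Integer as ℤ
import Data.Integer.Properties as ℤ
open import Data.List using (List; []; _∷_; [_]; length; filter; _++_; _ʳ++_; reverse; allFin; tabulate; take; lookup)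
open import Data.List.Properties using (++-assoc; ++-identityʳ; filter-++; filter-accept; filter-all; filter-complete; filter-reject; length-++; length-filter; length-take; reverse-involutive)
open import Data.List.Membership.Propositional using (_∈_)
open import Data.List.Membership.Propositional.Properties using (∈-allFin; ∈-∃++; ∈-filter⁺; ∈-filter⁻)
open import Data.List.Membership.Propositional.Properties.WithK using (unique∧set⇒bag)
open import Data.List.Relation.Binary.BagAndSetEquality using (∼bag⇒↭)
open import Data.List.Relation.Binary.Permutation.Propositional using (_↭_; prep; swap; ↭-refl; ↭-reflexive; ↭-sym; ↭-trans; ↭⇒↭ₛ)
import Data.List.Relation.Binary.Permutation.Propositional as ↭
open import Data.List.Relation.Binary.Permutation.Propositional.Properties using (All-resp-↭; drop-∷; filter-↭; shift; ++-comm; ++⁺ʳ; ++⁺ˡ; ¬x∷xs↭[]; ↭-length; ↭-reverse; ∈-resp-↭; ∷↭∷ʳ)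
import Data.List.Relation.Binary.Permutation.Setoid.Properties as ↭ₛ
open import Data.List.Relation.Unary.All using (All; []; _∷_)
import Data.List.Relation.Unary.All as All
import Data.List.Relation.Unary.All.Properties as All
open import Data.List.Relation.Unary.AllPairs using ([]; _∷_)
import Data.List.Relation.Unary.AllPairs as AllPairs
open import Data.List.Relation.Unary.Any using (here; there)
open import Data.List.Relation.Unary.Unique.Propositional using (Unique)
open import Data.List.Relation.Unary.Unique.Propositional.Properties using (allFin⁺; filter⁺; take⁺)
open import Data.Nat using (ℕ; zero; suc; pred; _⊔_; _∸_; z≤n; s≤s)
import Data.Nat as ℕ
import Data.Nat.Properties as ℕ
open import Data.Nat.Solver using (module +-*-Solver)
open import Data.Product using (∃; _×_; _,_; proj₁; proj₂)
open import Data.Rational using (ℚ; 0ℚ; 1ℚ; ½)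
import Data.Rational as ℚ
import Data.Rational.Properties as ℚ
open import Data.Rational.Unnormalised using (mkℚᵘ; *≡*)
import Data.Rational.Unnormalised as ℚᵘ
import Data.Rational.Unnormalised.Properties as ℚᵘ
open import Data.Sum using (_⊎_; inj₁; inj₂; fromInj₂)
import Data.Sum as Sum
open import Data.Vec.Functional using (updateAt)
open import Data.Vec.Functional.Properties using (updateAt-updates; updateAt-minimal)
open import Function using (_∘_; const; id)
open import Function.Bundles using (_⇔_; mk⇔; Equivalence)
open import Level using (0ℓ)
open import Relation.Binary.Construct.Closure.ReflexiveTransitive using (Star; fold)
open import Relation.Binary.PropositionalEquality using (_≡_; _≢_; refl; sym; trans; cong; cong₂; subst; subst₂; setoid; module ≡-Reasoning)
import Relation.Binary.Reasoning.Setoid as SetoidReasoning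
open import Relation.Nullary using (¬_; Dec; yes; no; contradiction)
open import Relation.Unary using (Pred; Decidable)

open CommutativeSemigroupProperties (CommutativeMonoid.commutativeSemigroup ℚ.+-0-commutativeMonoid)
  using (interchange; x∙yz≈y∙xz)
open GroupProperties ℚ.+-0-group using (∙-cancelʳ; //-rightDividesˡ; ⁻¹-anti-homo-//)

-- Natural numbers as rationals, and the mean excess of a vertex.

⟦_⟧ : ℕ → ℚ
⟦ n ⟧ = + n ℚ./ 1

⟦⟧-+ : ∀ m n → ⟦ m ℕ.+ n ⟧ ≡ ⟦ m ⟧ ℚ.+ ⟦ n ⟧
⟦⟧-+ m n = ℚ.toℚᵘ-injective (begin
  ℚ.toℚᵘ ⟦ m ℕ.+ n ⟧                            ≈⟨ ℚ.toℚᵘ-fromℚᵘ (mkℚᵘ (+ (m ℕ.+ n)) 0) ⟩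
  mkℚᵘ (+ (m ℕ.+ n)) 0                          ≈⟨ *≡* (cong (ℤ._* + 1) (trans (ℤ.pos-+ m n)
                                                     (sym (cong₂ ℤ._+_ (ℤ.*-identityʳ (+ m)) (ℤ.*-identityʳ (+ n)))))) ⟩
  mkℚᵘ (+ m) 0 ℚᵘ.+ mkℚᵘ (+ n) 0                ≈⟨ ℚᵘ.+-cong (ℚ.toℚᵘ-fromℚᵘ (mkℚᵘ (+ m) 0))
                                                     (ℚ.toℚᵘ-fromℚᵘ (mkℚᵘ (+ n) 0)) ⟨
  ℚ.toℚᵘ ⟦ m ⟧ ℚᵘ.+ ℚ.toℚᵘ ⟦ n ⟧                ≈⟨ ℚ.toℚᵘ-homo-+ ⟦ m ⟧ ⟦ n ⟧ ⟨
  ℚ.toℚᵘ (⟦ m ⟧ ℚ.+ ⟦ n ⟧)                      ∎)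
  where open SetoidReasoning ℚᵘ.≃-setoid

*-/-cancel : ∀ d i → ⟦ suc d ⟧ ℚ.* (i ℚ./ suc d) ≡ i ℚ./ 1
*-/-cancel d i = ℚ.toℚᵘ-injective (begin
  ℚ.toℚᵘ (⟦ suc d ⟧ ℚ.* (i ℚ./ suc d))          ≈⟨ ℚ.toℚᵘ-homo-* ⟦ suc d ⟧ (i ℚ./ suc d) ⟩
  ℚ.toℚᵘ ⟦ suc d ⟧ ℚᵘ.* ℚ.toℚᵘ (i ℚ./ suc d)    ≈⟨ ℚᵘ.*-cong (ℚ.toℚᵘ-fromℚᵘ (mkℚᵘ (+ suc d) 0))
                                                     (ℚ.toℚᵘ-fromℚᵘ (mkℚᵘ i d)) ⟩
  mkℚᵘ (+ suc d) 0 ℚᵘ.* mkℚᵘ i d                ≈⟨ *≡* (trans (ℤ.*-identityʳ _) (trans (ℤ.*-comm (+ suc d) i)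
                                                     (cong (λ m → i ℤ.* + suc m) (sym (ℕ.+-identityʳ d))))) ⟩
  mkℚᵘ i 0                                      ≈⟨ ℚ.toℚᵘ-fromℚᵘ (mkℚᵘ i 0) ⟨
  ℚ.toℚᵘ (i ℚ./ 1)                              ∎)
  where open SetoidReasoning ℚᵘ.≃-setoid

⟦⟧-suc : ∀ n → ⟦ suc n ⟧ ≡ 1ℚ ℚ.+ ⟦ n ⟧
⟦⟧-suc n = ⟦⟧-+ 1 n

0<⟦suc⟧ : ∀ n → 0ℚ ℚ.< ⟦ suc n ⟧
0<⟦suc⟧ n = ℚ.positive⁻¹ ⟦ suc n ⟧ {{ℚ.normalize-pos (suc n) 1}}

⟦suc⟧* : ∀ n q → ⟦ suc n ⟧ ℚ.* q ≡ q ℚ.+ ⟦ n ⟧ ℚ.* q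
⟦suc⟧* n q = trans (cong (ℚ._* q) (⟦⟧-suc n))
  (trans (ℚ.*-distribʳ-+ q 1ℚ ⟦ n ⟧) (cong (ℚ._+ ⟦ n ⟧ ℚ.* q) (ℚ.*-identityˡ q)))

*⟦suc⟧ : ∀ n q → q ℚ.* ⟦ suc n ⟧ ≡ q ℚ.+ q ℚ.* ⟦ n ⟧
*⟦suc⟧ n q = trans (cong (q ℚ.*_) (⟦⟧-suc n))
  (trans (ℚ.*-distribˡ-+ q 1ℚ ⟦ n ⟧) (cong (ℚ._+ q ℚ.* ⟦ n ⟧) (ℚ.*-identityʳ q)))

-- triangle k d is ∑ max(0, j − k) over 0 ≤ j ≤ d, and meanExcess k d the average of these d + 1 terms.
triangle : ℕ → ℕ → ℕ
triangle k zero    = 0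
triangle k (suc d) = (suc d ∸ k) ℕ.+ triangle k d

meanExcess : ℕ → ℕ → ℚ
meanExcess k d = + triangle k d ℚ./ suc d

-- Splits off the term j = d from the d + 1 averaged terms. For d = 0 the default value of `pred 0`
-- is harmless, because its factor is 0.
meanExcess-rec : ∀ k d →
  ⟦ suc d ⟧ ℚ.* meanExcess k d ≡ ⟦ d ∸ k ⟧ ℚ.+ ⟦ d ⟧ ℚ.* meanExcess k (pred d)
meanExcess-rec k zero    rewrite ℕ.0∸n≡0 k = refl
meanExcess-rec k (suc d) = begin
  ⟦ suc (suc d) ⟧ ℚ.* meanExcess k (suc d)              ≡⟨ *-/-cancel (suc d) (+ triangle k (suc d)) ⟩
  ⟦ (suc d ∸ k) ℕ.+ triangle k d ⟧                      ≡⟨ ⟦⟧-+ (suc d ∸ k) (triangle k d) ⟩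
  ⟦ suc d ∸ k ⟧ ℚ.+ ⟦ triangle k d ⟧                    ≡⟨ cong (⟦ suc d ∸ k ⟧ ℚ.+_) (*-/-cancel d (+ triangle k d)) ⟨
  ⟦ suc d ∸ k ⟧ ℚ.+ ⟦ suc d ⟧ ℚ.* meanExcess k d        ∎
  where open ≡-Reasoning

-- Sums over the removals of one entry from a list.

module _ {A : Set} where

  -- The sum of F v r over all ways to remove one entry v from a list, leaving r.
  ∑ᵖ : List A → (A → List A → ℚ) → ℚ
  ∑ᵖ []       F = 0ℚ
  ∑ᵖ (x ∷ xs) F = F x xs ℚ.+ ∑ᵖ xs (λ v r → F v (x ∷ r))

  ↭-under : ∀ {x v : A} {r xs} → v ∷ r ↭ xs → v ∷ x ∷ r ↭ x ∷ xs
  ↭-under p = ↭-trans (swap _ _ ↭-refl) (prep _ p)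

  ∑ᵖ-cong : ∀ L {F F′ : A → List A → ℚ} →
            (∀ v r → v ∷ r ↭ L → F v r ≡ F′ v r) → ∑ᵖ L F ≡ ∑ᵖ L F′
  ∑ᵖ-cong []       eq = refl
  ∑ᵖ-cong (x ∷ xs) eq = cong₂ ℚ._+_ (eq x xs ↭-refl) (∑ᵖ-cong xs λ v r p → eq v (x ∷ r) (↭-under p))

  ∑ᵖ-+ : ∀ L (F F′ : A → List A → ℚ) →
         ∑ᵖ L (λ v r → F v r ℚ.+ F′ v r) ≡ ∑ᵖ L F ℚ.+ ∑ᵖ L F′
  ∑ᵖ-+ []       F F′ = refl
  ∑ᵖ-+ (x ∷ xs) F F′ = trans (cong (F x xs ℚ.+ F′ x xs ℚ.+_) (∑ᵖ-+ xs _ _))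
    (interchange (F x xs) (F′ x xs) _ _)

  ∑ᵖ-*ˡ : ∀ L q (F : A → List A → ℚ) → ∑ᵖ L (λ v r → q ℚ.* F v r) ≡ q ℚ.* ∑ᵖ L F
  ∑ᵖ-*ˡ []       q F = sym (ℚ.*-zeroʳ q)
  ∑ᵖ-*ˡ (x ∷ xs) q F = trans (cong (q ℚ.* F x xs ℚ.+_) (∑ᵖ-*ˡ xs q _)) (sym (ℚ.*-distribˡ-+ q _ _))

  ∑ᵖ-const : ∀ L q → ∑ᵖ L (λ _ _ → q) ≡ ⟦ length L ⟧ ℚ.* q
  ∑ᵖ-const []       q = sym (ℚ.*-zeroˡ q)
  ∑ᵖ-const (x ∷ xs) q = trans (cong (q ℚ.+_) (∑ᵖ-const xs q)) (sym (⟦suc⟧* (length xs) q))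

  -- Both sides run over the ordered pairs of distinct positions of `L`, and what two removals leave
  -- does not depend on their order.
  ∑ᵖ-swap : ∀ L (F : A → A → List A → ℚ) →
            ∑ᵖ L (λ v r → ∑ᵖ r (λ u s → F v u s)) ≡ ∑ᵖ L (λ u r → ∑ᵖ r (λ v s → F v u s))
  ∑ᵖ-swap []       F = refl
  ∑ᵖ-swap (x ∷ xs) F = begin
    X ℚ.+ ∑ᵖ xs (λ v r → F v x r ℚ.+ ∑ᵖ r (λ u s → F v u (x ∷ s)))
      ≡⟨ cong (X ℚ.+_) (∑ᵖ-+ xs _ _) ⟩
    X ℚ.+ (Y ℚ.+ ∑ᵖ xs (λ v r → ∑ᵖ r (λ u s → F v u (x ∷ s))))
      ≡⟨ cong (λ z → X ℚ.+ (Y ℚ.+ z)) (∑ᵖ-swap xs (λ v u s → F v u (x ∷ s))) ⟩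
    X ℚ.+ (Y ℚ.+ Z)
      ≡⟨ x∙yz≈y∙xz X Y Z ⟩
    Y ℚ.+ (X ℚ.+ Z)
      ≡⟨ cong (Y ℚ.+_) (∑ᵖ-+ xs _ _) ⟨
    Y ℚ.+ ∑ᵖ xs (λ u r → F x u r ℚ.+ ∑ᵖ r (λ v s → F v u (x ∷ s))) ∎
    where
    open ≡-Reasoning
    X = ∑ᵖ xs (λ u s → F x u s)
    Y = ∑ᵖ xs (λ v s → F v x s)
    Z = ∑ᵖ xs (λ u r → ∑ᵖ r (λ v s → F v u (x ∷ s)))

-- Inequalities between reals, on the level of rational sequences.

Sequence : Set
Sequence = ℕ → ℚ

-- x ≤ y on ℝ, on the level of sequences; a record, so that x and y can be inferred.
infix 4 _≲_ _≋_
record _≲_ (x y : Sequence) : Set where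
  constructor limit
  field
    eventually : ∀ ε → 0ℚ ℚ.< ε → ∃ λ N → ∀ t → N ℕ.≤ t → x t ℚ.≤ y t ℚ.+ ε

open _≲_ public

_≋_ : Sequence → Sequence → Set
x ≋ y = x ≲ y × y ≲ x

infixl 6 _⊕_
_⊕_ : Sequence → Sequence → Sequence
(x ⊕ y) t = x t ℚ.+ y t

-- The properties shared by _≲_ and its converse that the averaging argument needs.
record IsAdditive (_∼_ : Sequence → Sequence → Set) : Set where
  field
    reflexive : ∀ {x y} → (∀ t → x t ≡ y t) → x ∼ y
    ∼-trans   : ∀ {x y z} → x ∼ y → y ∼ z → x ∼ z
    +-mono    : ∀ {w x y z} → w ∼ x → y ∼ z → (w ⊕ y) ∼ (x ⊕ z)
    *-cancel  : ∀ m {x y} → (λ t → ⟦ suc m ⟧ ℚ.* x t) ∼ (λ t → ⟦ suc m ⟧ ℚ.* y t) → x ∼ y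

  ∑ᵖ-mono : ∀ {A : Set} L {F F′ : ℕ → A → List A → ℚ} →
            (∀ v r → v ∷ r ↭ L → (λ t → F t v r) ∼ (λ t → F′ t v r)) →
            (λ t → ∑ᵖ L (F t)) ∼ (λ t → ∑ᵖ L (F′ t))
  ∑ᵖ-mono []       p = reflexive λ _ → refl
  ∑ᵖ-mono (x ∷ xs) p = +-mono (p x xs ↭-refl) (∑ᵖ-mono xs λ v r q → p v (x ∷ r) (↭-under q))

0<½* : ∀ {ε} → 0ℚ ℚ.< ε → 0ℚ ℚ.< ½ ℚ.* ε
0<½* {ε} 0<ε = ℚ.*-monoʳ-<-pos ½ 0<ε

½+½ : ∀ ε → ½ ℚ.* ε ℚ.+ ½ ℚ.* ε ≡ ε
½+½ ε = trans (sym (ℚ.*-distribʳ-+ ε ½ ½)) (ℚ.*-identityˡ ε)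

≲-pointwise : ∀ {x y} → (∀ t → x t ℚ.≤ y t) → x ≲ y
≲-pointwise {x} {y} p = limit λ ε 0<ε → 0 , λ t _ →
  subst (ℚ._≤ y t ℚ.+ ε) (ℚ.+-identityʳ (x t)) (ℚ.+-mono-≤ (p t) (ℚ.<⇒≤ 0<ε))

≲-reflexive : ∀ {x y} → (∀ t → x t ≡ y t) → x ≲ y
≲-reflexive eq = ≲-pointwise λ t → ℚ.≤-reflexive (eq t)

≲-trans : ∀ {x y z} → x ≲ y → y ≲ z → x ≲ z
≲-trans {x} {y} {z} (limit p) (limit q) .eventually ε 0<ε with p (½ ℚ.* ε) (0<½* 0<ε) | q (½ ℚ.* ε) (0<½* 0<ε)
... | M , p′ | N , q′ = M ⊔ N , λ t M⊔N≤t → begin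
  x t                                  ≤⟨ p′ t (ℕ.m⊔n≤o⇒m≤o M N M⊔N≤t) ⟩
  y t ℚ.+ ½ ℚ.* ε                      ≤⟨ ℚ.+-monoˡ-≤ (½ ℚ.* ε) (q′ t (ℕ.m⊔n≤o⇒n≤o M N M⊔N≤t)) ⟩
  z t ℚ.+ ½ ℚ.* ε ℚ.+ ½ ℚ.* ε          ≡⟨ ℚ.+-assoc (z t) (½ ℚ.* ε) (½ ℚ.* ε) ⟩
  z t ℚ.+ (½ ℚ.* ε ℚ.+ ½ ℚ.* ε)        ≡⟨ cong (z t ℚ.+_) (½+½ ε) ⟩
  z t ℚ.+ ε                            ∎
  where open ℚ.≤-Reasoning

≲-+-mono : ∀ {w x y z} → w ≲ x → y ≲ z → w ⊕ y ≲ x ⊕ z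
≲-+-mono {w} {x} {y} {z} (limit p) (limit q) .eventually ε 0<ε with p (½ ℚ.* ε) (0<½* 0<ε) | q (½ ℚ.* ε) (0<½* 0<ε)
... | M , p′ | N , q′ = M ⊔ N , λ t M⊔N≤t → begin
  w t ℚ.+ y t                                    ≤⟨ ℚ.+-mono-≤ (p′ t (ℕ.m⊔n≤o⇒m≤o M N M⊔N≤t))
                                                                 (q′ t (ℕ.m⊔n≤o⇒n≤o M N M⊔N≤t)) ⟩
  (x t ℚ.+ ½ ℚ.* ε) ℚ.+ (z t ℚ.+ ½ ℚ.* ε)        ≡⟨ interchange (x t) (½ ℚ.* ε) (z t) (½ ℚ.* ε) ⟩
  (x t ℚ.+ z t) ℚ.+ (½ ℚ.* ε ℚ.+ ½ ℚ.* ε)        ≡⟨ cong (x t ℚ.+ z t ℚ.+_) (½+½ ε) ⟩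
  (x t ℚ.+ z t) ℚ.+ ε                            ∎
  where open ℚ.≤-Reasoning

+-cancelˡ-≤ : ∀ p {q r} → p ℚ.+ q ℚ.≤ p ℚ.+ r → q ℚ.≤ r
+-cancelˡ-≤ p {q} {r} le = subst₂ ℚ._≤_ (-p+p+ q) (-p+p+ r) (ℚ.+-monoʳ-≤ (ℚ.- p) le)
  where
  -p+p+ : ∀ s → ℚ.- p ℚ.+ (p ℚ.+ s) ≡ s
  -p+p+ s = trans (sym (ℚ.+-assoc (ℚ.- p) p s)) (trans (cong (ℚ._+ s) (ℚ.+-inverseˡ p)) (ℚ.+-identityˡ s))

≲-+-cancelˡ : ∀ x {y z} → x ⊕ y ≲ x ⊕ z → y ≲ z
≲-+-cancelˡ x {y} {z} (limit p) .eventually ε 0<ε with p ε 0<ε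
... | N , q = N , λ t N≤t → +-cancelˡ-≤ (x t) (subst (x t ℚ.+ y t ℚ.≤_) (ℚ.+-assoc (x t) (z t) ε) (q t N≤t))

≲-*-cancel : ∀ m {x y} → (λ t → ⟦ suc m ⟧ ℚ.* x t) ≲ (λ t → ⟦ suc m ⟧ ℚ.* y t) → x ≲ y
≲-*-cancel m {x} {y} (limit p) .eventually ε 0<ε with p (⟦ suc m ⟧ ℚ.* ε) 0<mε
  where
  instance _ = ℚ.positive (0<⟦suc⟧ m)
  0<mε = subst (ℚ._< ⟦ suc m ⟧ ℚ.* ε) (ℚ.*-zeroʳ ⟦ suc m ⟧) (ℚ.*-monoʳ-<-pos ⟦ suc m ⟧ 0<ε)
... | N , q = N , λ t N≤t → ℚ.*-cancelˡ-≤-pos ⟦ suc m ⟧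
    (subst (⟦ suc m ⟧ ℚ.* x t ℚ.≤_) (sym (ℚ.*-distribˡ-+ ⟦ suc m ⟧ (y t) ε)) (q t N≤t))
  where instance _ = ℚ.positive (0<⟦suc⟧ m)

≲-isAdditive : IsAdditive _≲_
≲-isAdditive = record
  { reflexive = ≲-reflexive ; ∼-trans = ≲-trans ; +-mono = ≲-+-mono ; *-cancel = ≲-*-cancel }

≳-isAdditive : IsAdditive (λ x y → y ≲ x)
≳-isAdditive = record
  { reflexive = λ eq → ≲-reflexive (λ t → sym (eq t)) ; ∼-trans = λ p q → ≲-trans q p
  ; +-mono = ≲-+-mono ; *-cancel = λ m p → ≲-*-cancel m p }

≲-*⟦⟧ : ∀ m {x y} → x ≲ y → (λ t → x t ℚ.* ⟦ m ⟧) ≲ (λ t → y t ℚ.* ⟦ m ⟧)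
≲-*⟦⟧ zero    {x} {y} p = ≲-reflexive (λ t → trans (ℚ.*-zeroʳ (x t)) (sym (ℚ.*-zeroʳ (y t))))
≲-*⟦⟧ (suc m) {x} {y} p = ≲-trans (≲-reflexive λ t → *⟦suc⟧ m (x t))
  (≲-trans (≲-+-mono p (≲-*⟦⟧ m p)) (≲-reflexive λ t → sym (*⟦suc⟧ m (y t))))

≲-refl : ∀ {x} → x ≲ x
≲-refl = ≲-reflexive λ _ → refl

≋-sym : ∀ {x y} → x ≋ y → y ≋ x
≋-sym (p , q) = q , p

≋-trans : ∀ {x y z} → x ≋ y → y ≋ z → x ≋ z
≋-trans (p , q) (p′ , q′) = ≲-trans p p′ , ≲-trans q′ q

≋-reflexive : ∀ {x y} → (∀ t → x t ≡ y t) → x ≋ y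
≋-reflexive eq = ≲-reflexive eq , ≲-reflexive (sym ∘ eq)

≋-+-mono : ∀ {w x y z} → w ≋ x → y ≋ z → w ⊕ y ≋ x ⊕ z
≋-+-mono (p , p′) (q , q′) = ≲-+-mono p q , ≲-+-mono p′ q′

≋-+-cancelˡ : ∀ x {y z} → x ⊕ y ≋ x ⊕ z → y ≋ z
≋-+-cancelˡ x (p , q) = ≲-+-cancelˡ x p , ≲-+-cancelˡ x q

-- When no term of F exceeds its counterpart in F′, yet the total of F′ does not exceed that of F,
-- no single term can be slack: bounding all other terms of F by those of F′ and cancelling them
-- leaves the reverse inequality for the chosen term.
∑ᵖ-tight : ∀ {A : Set} L {F F′ : ℕ → A → List A → ℚ} →
  (∀ v r → v ∷ r ↭ L → (λ t → F t v r) ≲ (λ t → F′ t v r)) →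
  (λ t → ∑ᵖ L (F′ t)) ≲ (λ t → ∑ᵖ L (F t)) →
  ∀ {v} → v ∈ L → ∃ λ r → v ∷ r ↭ L × (λ t → F′ t v r) ≲ (λ t → F t v r)
∑ᵖ-tight (x ∷ xs) {F} {F′} p s (here refl) = xs , ↭-refl , ≲-+-cancelˡ rest′
  (≲-trans (≲-reflexive λ t → ℚ.+-comm (rest′ t) (F′ t x xs))
    (≲-trans s (≲-trans (≲-+-mono (≲-refl {λ t → F t x xs})
        (IsAdditive.∑ᵖ-mono ≲-isAdditive xs λ v r q → p v (x ∷ r) (↭-under q)))
      (≲-reflexive λ t → ℚ.+-comm (F t x xs) (rest′ t)))))
  where
  rest′ : Sequence
  rest′ t = ∑ᵖ xs (λ v r → F′ t v (x ∷ r))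
∑ᵖ-tight (x ∷ xs) {F} {F′} p s (there v∈xs)
  with ∑ᵖ-tight xs (λ v r q → p v (x ∷ r) (↭-under q))
         (≲-+-cancelˡ (λ t → F′ t x xs)
           (≲-trans s (≲-+-mono (p x xs ↭-refl) ≲-refl))) v∈xs
... | r , q , z = x ∷ r , ↭-under q , z

-- The mean excess under removal of one entry.

module _ {A : Set} {P : Pred A 0ℓ} (P? : Decidable P) where

  private
    count : List A → ℕ
    count r = length (filter P? r)

    -- For m = 0 the arguments of g differ, but both values are multiplied by 0.
    *-suc-pred : ∀ m (g : ℕ → ℚ) → ⟦ m ⟧ ℚ.* g (suc (pred m)) ≡ ⟦ m ⟧ ℚ.* g m
    *-suc-pred zero    g = trans (ℚ.*-zeroˡ (g 1)) (sym (ℚ.*-zeroˡ (g 0)))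
    *-suc-pred (suc m) g = refl

  -- Of the entries of r, count r lower the count by one when removed and the others do not
  -- change it; the term ⟦ count r ⟧ * g (count r) is moved to the left to avoid a subtraction.
  ∑ᵖ-count : ∀ r (g : ℕ → ℚ) →
    ∑ᵖ r (λ _ s → g (count s)) ℚ.+ ⟦ count r ⟧ ℚ.* g (count r)
      ≡ ⟦ length r ⟧ ℚ.* g (count r) ℚ.+ ⟦ count r ⟧ ℚ.* g (pred (count r))
  ∑ᵖ-count []       g = cong (ℚ._+ 0ℚ ℚ.* g 0) (sym (ℚ.*-zeroˡ (g 0)))
  ∑ᵖ-count (x ∷ xs) g with P? x
  ... | no _ = begin
    (g M ℚ.+ Σ) ℚ.+ ⟦ M ⟧ ℚ.* g M
      ≡⟨ ℚ.+-assoc (g M) Σ (⟦ M ⟧ ℚ.* g M) ⟩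
    g M ℚ.+ (Σ ℚ.+ ⟦ M ⟧ ℚ.* g M)
      ≡⟨ cong (g M ℚ.+_) (∑ᵖ-count xs g) ⟩
    g M ℚ.+ (⟦ m ⟧ ℚ.* g M ℚ.+ ⟦ M ⟧ ℚ.* g (pred M))
      ≡⟨ ℚ.+-assoc (g M) (⟦ m ⟧ ℚ.* g M) (⟦ M ⟧ ℚ.* g (pred M)) ⟨
    (g M ℚ.+ ⟦ m ⟧ ℚ.* g M) ℚ.+ ⟦ M ⟧ ℚ.* g (pred M)
      ≡⟨ cong (ℚ._+ ⟦ M ⟧ ℚ.* g (pred M)) (⟦suc⟧* m (g M)) ⟨
    ⟦ suc m ⟧ ℚ.* g M ℚ.+ ⟦ M ⟧ ℚ.* g (pred M) ∎
    where
    open ≡-Reasoning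
    M = count xs
    m = length xs
    Σ = ∑ᵖ xs (λ _ s → g (count s))
  ... | yes _ = begin
    (g M ℚ.+ Σ) ℚ.+ ⟦ suc M ⟧ ℚ.* g (suc M)
      ≡⟨ cong (g M ℚ.+ Σ ℚ.+_) (⟦suc⟧* M (g (suc M))) ⟩
    (g M ℚ.+ Σ) ℚ.+ (g (suc M) ℚ.+ ⟦ M ⟧ ℚ.* g (suc M))
      ≡⟨ interchange (g M) Σ (g (suc M)) (⟦ M ⟧ ℚ.* g (suc M)) ⟩
    (g M ℚ.+ g (suc M)) ℚ.+ (Σ ℚ.+ ⟦ M ⟧ ℚ.* g (suc M))
      ≡⟨ cong₂ ℚ._+_ (ℚ.+-comm (g M) (g (suc M)))
          -- Every remainder still contains x, which raises its count by one; hence the induction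
          -- hypothesis for the shifted g.
          (trans (∑ᵖ-count xs (λ i → g (suc i))) (cong (⟦ m ⟧ ℚ.* g (suc M) ℚ.+_) (*-suc-pred M g))) ⟩
    (g (suc M) ℚ.+ g M) ℚ.+ (⟦ m ⟧ ℚ.* g (suc M) ℚ.+ ⟦ M ⟧ ℚ.* g M)
      ≡⟨ interchange (g (suc M)) (g M) (⟦ m ⟧ ℚ.* g (suc M)) (⟦ M ⟧ ℚ.* g M) ⟩
    (g (suc M) ℚ.+ ⟦ m ⟧ ℚ.* g (suc M)) ℚ.+ (g M ℚ.+ ⟦ M ⟧ ℚ.* g M)
      ≡⟨ cong₂ ℚ._+_ (⟦suc⟧* m (g (suc M))) (⟦suc⟧* M (g M)) ⟨
    ⟦ suc m ⟧ ℚ.* g (suc M) ℚ.+ ⟦ suc M ⟧ ℚ.* g M ∎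
    where
    open ≡-Reasoning
    M = count xs
    m = length xs
    Σ = ∑ᵖ xs (λ _ s → g (suc (count s)))

  -- Read `P` as adjacency to a vertex u outside r. The left side runs over the choices of the last
  -- vertex among u and r: u itself has excess `count r ∸ k`, and any other choice leaves u with the
  -- remainder s. The equation is `∑ᵖ-count` combined with `meanExcess-rec`, after adding the same
  -- term to both sides.
  ∑ᵖ-meanExcess : ∀ k r →
    ⟦ count r ∸ k ⟧ ℚ.+ ∑ᵖ r (λ _ s → meanExcess k (count s)) ≡ ⟦ suc (length r) ⟧ ℚ.* meanExcess k (count r)
  ∑ᵖ-meanExcess k r = ∙-cancelʳ (⟦ M ⟧ ℚ.* g M) _ _ (begin
    (h ℚ.+ Σ) ℚ.+ ⟦ M ⟧ ℚ.* g M
      ≡⟨ ℚ.+-assoc h Σ (⟦ M ⟧ ℚ.* g M) ⟩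
    h ℚ.+ (Σ ℚ.+ ⟦ M ⟧ ℚ.* g M)
      ≡⟨ cong (h ℚ.+_) (∑ᵖ-count r g) ⟩
    h ℚ.+ (⟦ m ⟧ ℚ.* g M ℚ.+ ⟦ M ⟧ ℚ.* g (pred M))
      ≡⟨ x∙yz≈y∙xz h (⟦ m ⟧ ℚ.* g M) (⟦ M ⟧ ℚ.* g (pred M)) ⟩
    ⟦ m ⟧ ℚ.* g M ℚ.+ (h ℚ.+ ⟦ M ⟧ ℚ.* g (pred M))
      ≡⟨ cong (⟦ m ⟧ ℚ.* g M ℚ.+_) (trans (sym (meanExcess-rec k M)) (⟦suc⟧* M (g M))) ⟩
    ⟦ m ⟧ ℚ.* g M ℚ.+ (g M ℚ.+ ⟦ M ⟧ ℚ.* g M)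
      ≡⟨ x∙yz≈y∙xz (⟦ m ⟧ ℚ.* g M) (g M) (⟦ M ⟧ ℚ.* g M) ⟩
    g M ℚ.+ (⟦ m ⟧ ℚ.* g M ℚ.+ ⟦ M ⟧ ℚ.* g M)
      ≡⟨ ℚ.+-assoc (g M) (⟦ m ⟧ ℚ.* g M) (⟦ M ⟧ ℚ.* g M) ⟨
    (g M ℚ.+ ⟦ m ⟧ ℚ.* g M) ℚ.+ ⟦ M ⟧ ℚ.* g M
      ≡⟨ cong (ℚ._+ ⟦ M ⟧ ℚ.* g M) (⟦suc⟧* m (g M)) ⟨
    ⟦ suc m ⟧ ℚ.* g M ℚ.+ ⟦ M ⟧ ℚ.* g M ∎)
    where
    open ≡-Reasoning
    M = count r
    m = length r
    g = meanExcess k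
    h = ⟦ M ∸ k ⟧
    Σ = ∑ᵖ r (λ _ s → g (count s))

-- The average cost over all orderings.

module Averaging {n : ℕ} (G : Graph n) (k : Fin n → ℕ) where
  open Graph G

  N : Fin n → List (Fin n) → ℕ
  N = neighborsIn G

  N-↭ : ∀ u {r s} → r ↭ s → N u r ≡ N u s
  N-↭ u p = ↭-length (filter-↭ (adj? u) p)

  excess : (Fin n → ℚ) → Fin n → List (Fin n) → ℚ
  excess c v r = c v ℚ.* ⟦ N v r ∸ k v ⟧

  -- Orderings are listed backwards: v comes after all entries of r in v ∷ r.
  cost : (Fin n → ℚ) → List (Fin n) → ℚ
  cost c []      = 0ℚ
  cost c (v ∷ r) = excess c v r ℚ.+ cost c r

  -- For a duplicate-free `L` this is the right-hand side of the claim for the subgraph induced on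
  -- `L`, where v has degree `N v r`, with differences truncated at 0.
  mean : (Fin n → ℚ) → List (Fin n) → ℚ
  mean c L = ∑ᵖ L (λ v r → c v ℚ.* meanExcess (k v) (N v r))

  -- Choosing the last vertex v uniformly and averaging over the rest gives the average again.
  -- Exchanging the two removals collects the terms of each vertex u, which `∑ᵖ-meanExcess` then
  -- adds up.
  mean-rec : ∀ c L → ∑ᵖ L (λ v r → excess c v r ℚ.+ mean c r) ≡ ⟦ length L ⟧ ℚ.* mean c L
  mean-rec c L = begin
    ∑ᵖ L (λ v r → excess c v r ℚ.+ mean c r)
      ≡⟨ ∑ᵖ-+ L (excess c) (λ v r → mean c r) ⟩
    ∑ᵖ L (excess c) ℚ.+ ∑ᵖ L (λ v r → ∑ᵖ r (λ u s → c u ℚ.* meanExcess (k u) (N u s)))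
      ≡⟨ cong (∑ᵖ L (excess c) ℚ.+_) (∑ᵖ-swap L (λ v u s → c u ℚ.* meanExcess (k u) (N u s))) ⟩
    ∑ᵖ L (excess c) ℚ.+ ∑ᵖ L (λ u r → ∑ᵖ r (λ v s → c u ℚ.* meanExcess (k u) (N u s)))
      ≡⟨ ∑ᵖ-+ L (excess c) (λ u r → ∑ᵖ r (λ v s → c u ℚ.* meanExcess (k u) (N u s))) ⟨
    ∑ᵖ L (λ u r → excess c u r ℚ.+ ∑ᵖ r (λ v s → c u ℚ.* meanExcess (k u) (N u s)))
      ≡⟨ ∑ᵖ-cong L (λ u r p → term u r (↭-length p)) ⟩
    ∑ᵖ L (λ u r → ⟦ length L ⟧ ℚ.* (c u ℚ.* meanExcess (k u) (N u r)))
      ≡⟨ ∑ᵖ-*ˡ L ⟦ length L ⟧ (λ u r → c u ℚ.* meanExcess (k u) (N u r)) ⟩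
    ⟦ length L ⟧ ℚ.* mean c L ∎
    where
    open ≡-Reasoning
    term : ∀ u r → suc (length r) ≡ length L →
      excess c u r ℚ.+ ∑ᵖ r (λ v s → c u ℚ.* meanExcess (k u) (N u s))
        ≡ ⟦ length L ⟧ ℚ.* (c u ℚ.* meanExcess (k u) (N u r))
    term u r eq = begin
      excess c u r ℚ.+ ∑ᵖ r (λ v s → c u ℚ.* meanExcess (k u) (N u s))
        ≡⟨ cong (excess c u r ℚ.+_) (∑ᵖ-*ˡ r (c u) (λ v s → meanExcess (k u) (N u s))) ⟩
      excess c u r ℚ.+ c u ℚ.* ∑ᵖ r (λ v s → meanExcess (k u) (N u s))
        ≡⟨ ℚ.*-distribˡ-+ (c u) ⟦ N u r ∸ k u ⟧ (∑ᵖ r (λ v s → meanExcess (k u) (N u s))) ⟨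
      c u ℚ.* (⟦ N u r ∸ k u ⟧ ℚ.+ ∑ᵖ r (λ v s → meanExcess (k u) (N u s)))
        ≡⟨ cong (c u ℚ.*_) (∑ᵖ-meanExcess (adj? u) (k u) r) ⟩
      c u ℚ.* (⟦ suc (length r) ⟧ ℚ.* meanExcess (k u) (N u r))
        ≡⟨ cong (λ m → c u ℚ.* (⟦ m ⟧ ℚ.* meanExcess (k u) (N u r))) eq ⟩
      c u ℚ.* (⟦ length L ⟧ ℚ.* meanExcess (k u) (N u r))
        ≡⟨ ℚ.*-assoc (c u) ⟦ length L ⟧ (meanExcess (k u) (N u r)) ⟨
      c u ℚ.* ⟦ length L ⟧ ℚ.* meanExcess (k u) (N u r)
        ≡⟨ cong (ℚ._* meanExcess (k u) (N u r)) (ℚ.*-comm (c u) ⟦ length L ⟧) ⟩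
      ⟦ length L ⟧ ℚ.* c u ℚ.* meanExcess (k u) (N u r)
        ≡⟨ ℚ.*-assoc ⟦ length L ⟧ (c u) (meanExcess (k u) (N u r)) ⟩
      ⟦ length L ⟧ ℚ.* (c u ℚ.* meanExcess (k u) (N u r)) ∎

  module _ (c : ℕ → Fin n → ℚ) where

    costₛ meanₛ : List (Fin n) → Sequence
    costₛ L t = cost (c t) L
    meanₛ L t = mean (c t) L

    excessₛ : Fin n → List (Fin n) → Sequence
    excessₛ v r t = excess (c t) v r

    excess-↭ : ∀ v {r s} → r ↭ s → ∀ t → excessₛ v r t ≡ excessₛ v s t
    excess-↭ v p t = cong (λ m → c t v ℚ.* ⟦ m ∸ k v ⟧) (N-↭ v p)

    module _ {_∼_ : Sequence → Sequence → Set} (additive : IsAdditive _∼_) where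
      open IsAdditive additive

      -- A bound valid for all orderings is valid for their average. The offset `a` accumulates the
      -- excess of the vertices already placed after `L`; the induction hypothesis handles each
      -- choice of last vertex, and `mean-rec` averages over the choices.
      bounded-by-mean : ∀ m L → length L ≡ m → ∀ a b →
        (∀ L′ → L′ ↭ L → b ∼ (a ⊕ costₛ L′)) → b ∼ (a ⊕ meanₛ L)
      bounded-by-mean zero    [] _  a b p = p [] ↭-refl
      bounded-by-mean (suc m) L  eq a b p = *-cancel m
        (∼-trans (reflexive λ t → trans (cong (λ l → ⟦ l ⟧ ℚ.* b t) (sym eq)) (sym (∑ᵖ-const L (b t))))
          (∼-trans (∑ᵖ-mono L removed) (reflexive total)))
        where
        removed : ∀ v r → v ∷ r ↭ L → b ∼ (a ⊕ (excessₛ v r ⊕ meanₛ r))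
        removed v r q = ∼-trans
          (bounded-by-mean m r (ℕ.suc-injective (trans (↭-length q) eq)) (a ⊕ excessₛ v r) b λ r′ q′ →
            ∼-trans (p (v ∷ r′) (↭-trans (prep v q′) q)) (reflexive λ t →
              trans (sym (ℚ.+-assoc (a t) (excessₛ v r′ t) (costₛ r′ t)))
                (cong (λ e → a t ℚ.+ e ℚ.+ cost (c t) r′) (excess-↭ v q′ t))))
          (reflexive λ t → ℚ.+-assoc (a t) (excessₛ v r t) (meanₛ r t))
        total : ∀ t → ∑ᵖ L (λ v r → a t ℚ.+ (excessₛ v r t ℚ.+ meanₛ r t)) ≡ ⟦ suc m ⟧ ℚ.* (a t ℚ.+ meanₛ L t)
        total t = begin
          ∑ᵖ L (λ v r → a t ℚ.+ (excessₛ v r t ℚ.+ meanₛ r t))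
            ≡⟨ ∑ᵖ-+ L (λ _ _ → a t) (λ v r → excessₛ v r t ℚ.+ meanₛ r t) ⟩
          ∑ᵖ L (λ _ _ → a t) ℚ.+ ∑ᵖ L (λ v r → excessₛ v r t ℚ.+ meanₛ r t)
            ≡⟨ cong₂ ℚ._+_ (∑ᵖ-const L (a t)) (mean-rec (c t) L) ⟩
          ⟦ length L ⟧ ℚ.* a t ℚ.+ ⟦ length L ⟧ ℚ.* meanₛ L t
            ≡⟨ ℚ.*-distribˡ-+ ⟦ length L ⟧ (a t) (meanₛ L t) ⟨
          ⟦ length L ⟧ ℚ.* (a t ℚ.+ meanₛ L t)
            ≡⟨ cong (λ l → ⟦ l ⟧ ℚ.* (a t ℚ.+ meanₛ L t)) eq ⟩
          ⟦ suc m ⟧ ℚ.* (a t ℚ.+ meanₛ L t) ∎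
          where open ≡-Reasoning

    -- If no cost lies below the average, none lies above it. By `mean-rec` and `∑ᵖ-tight`, every
    -- choice of last vertex v has average exactly that of `L`; cancelling the excess of v passes
    -- the hypothesis on to the remainder r, and the induction continues there.
    cost≲mean : ∀ L → (∀ L′ → L′ ↭ L → meanₛ L ≲ costₛ L′) → ∀ L′ → L′ ↭ L → costₛ L′ ≲ meanₛ L
    cost≲mean []      p []       q = ≲-reflexive λ _ → refl
    cost≲mean (_ ∷ _) p []       q = contradiction (↭-sym q) ¬x∷xs↭[]
    cost≲mean L       p (v ∷ r′) q =
      let r , v∷r↭L , le = ∑ᵖ-tight L removed tight (∈-resp-↭ q (here refl))
          r′↭r = drop-∷ (↭-trans q (↭-sym v∷r↭L))
      in ≲-trans
        (≲-+-mono (≲-reflexive (excess-↭ v r′↭r))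
          (cost≲mean r (λ s s↭r → ≲-+-cancelˡ (excessₛ v r) (≲-trans le (extended v s r s↭r v∷r↭L))) r′ r′↭r))
        le
      where
      extended : ∀ v s r → s ↭ r → v ∷ r ↭ L → meanₛ L ≲ excessₛ v r ⊕ costₛ s
      extended v s r s↭r v∷r↭L = ≲-trans (p (v ∷ s) (↭-trans (prep v s↭r) v∷r↭L))
        (≲-reflexive λ t → cong (ℚ._+ costₛ s t) (excess-↭ v s↭r t))
      removed : ∀ v r → v ∷ r ↭ L → meanₛ L ≲ excessₛ v r ⊕ meanₛ r
      removed v r v∷r↭L = bounded-by-mean ≲-isAdditive (length r) r refl (excessₛ v r) (meanₛ L)
        λ s s↭r → extended v s r s↭r v∷r↭L
      tight : (λ t → ∑ᵖ L (λ v r → excessₛ v r t ℚ.+ meanₛ r t)) ≲ (λ t → ∑ᵖ L (λ _ _ → meanₛ L t))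
      tight = ≲-reflexive λ t → trans (mean-rec (c t) L) (sym (∑ᵖ-const L (meanₛ L t)))

-- Real equality as a pair of inequalities.

p≤∣p∣ : ∀ p → p ℚ.≤ ℚ.∣ p ∣
p≤∣p∣ p with ℚ.≤-total 0ℚ p
... | inj₁ 0≤p = ℚ.≤-reflexive (sym (ℚ.0≤p⇒∣p∣≡p 0≤p))
... | inj₂ p≤0 = ℚ.≤-trans p≤0 (ℚ.0≤∣p∣ p)

p-q≤r⇒p≤q+r : ∀ {p q r} → p ℚ.- q ℚ.≤ r → p ℚ.≤ q ℚ.+ r
p-q≤r⇒p≤q+r {p} {q} {r} le = subst₂ ℚ._≤_ (//-rightDividesˡ q p) (ℚ.+-comm r q) (ℚ.+-monoˡ-≤ q le)

p≤q+r⇒p-q≤r : ∀ {p q r} → p ℚ.≤ q ℚ.+ r → p ℚ.- q ℚ.≤ r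
p≤q+r⇒p-q≤r {p} {q} {r} le = +-cancelˡ-≤ q
  (subst (ℚ._≤ q ℚ.+ r) (sym (trans (ℚ.+-comm q (p ℚ.- q)) (//-rightDividesˡ q p))) le)

≈⇒≲ : ∀ {x y} → x ≈ y → seq x ≲ seq y
≈⇒≲ {x} {y} x≈y = limit λ ε 0<ε → let N , p = x≈y ε 0<ε in
  N , λ t N≤t → p-q≤r⇒p≤q+r (ℚ.≤-trans (p≤∣p∣ (seq x t ℚ.- seq y t)) (p t N≤t))

≈-sym : ∀ {x y} → x ≈ y → y ≈ x
≈-sym {x} {y} x≈y ε 0<ε = let N , p = x≈y ε 0<ε in N , λ t N≤t →
  subst (ℚ._≤ ε) (trans (sym (ℚ.∣-p∣≡∣p∣ (seq x t ℚ.- seq y t)))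
    (cong ℚ.∣_∣ (⁻¹-anti-homo-// (seq x t) (seq y t)))) (p t N≤t)

≈⇒≋ : ∀ {x y} → x ≈ y → seq x ≋ seq y
≈⇒≋ {x} {y} x≈y = ≈⇒≲ {x} {y} x≈y , ≈⇒≲ {y} {x} (≈-sym {x} {y} x≈y)

≋⇒≈ : ∀ {x y} → seq x ≋ seq y → x ≈ y
≋⇒≈ {x} {y} (p , q) ε 0<ε = let M , p′ = p .eventually ε 0<ε ; N , q′ = q .eventually ε 0<ε in
  M ℕ.⊔ N , λ t M⊔N≤t → ∣-∣≤ (seq x t) (seq y t)
    (p′ t (ℕ.m⊔n≤o⇒m≤o M N M⊔N≤t)) (q′ t (ℕ.m⊔n≤o⇒n≤o M N M⊔N≤t))
  where
  ∣-∣≤ : ∀ a b → a ℚ.≤ b ℚ.+ ε → b ℚ.≤ a ℚ.+ ε → ℚ.∣ a ℚ.- b ∣ ℚ.≤ ε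
  ∣-∣≤ a b a≤ b≤ with ℚ.∣p∣≡p∨∣p∣≡-p (a ℚ.- b)
  ... | inj₁ eq = subst (ℚ._≤ ε) (sym eq) (p≤q+r⇒p-q≤r a≤)
  ... | inj₂ eq = subst (ℚ._≤ ε) (sym (trans eq (⁻¹-anti-homo-// a b))) (p≤q+r⇒p-q≤r b≤)

-- The mean excess as the coefficient in the claim.

2*triangle : ∀ k d → 2 ℕ.* triangle k d ≡ (d ∸ k) ℕ.* (d ∸ k ℕ.+ 1)
2*triangle k zero rewrite ℕ.0∸n≡0 k = refl
2*triangle k (suc d) with k ℕ.≤? d
... | yes k≤d = begin
  2 ℕ.* ((suc d ∸ k) ℕ.+ triangle k d)             ≡⟨ ℕ.*-distribˡ-+ 2 (suc d ∸ k) (triangle k d) ⟩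
  2 ℕ.* (suc d ∸ k) ℕ.+ 2 ℕ.* triangle k d         ≡⟨ cong₂ (λ a b → 2 ℕ.* a ℕ.+ b)
                                                        (ℕ.+-∸-assoc 1 k≤d) (2*triangle k d) ⟩
  2 ℕ.* suc e ℕ.+ e ℕ.* (e ℕ.+ 1)                  ≡⟨ solve 1 (λ e → con 2 :* (con 1 :+ e) :+ e :* (e :+ con 1)
                                                        := (con 1 :+ e) :* (con 1 :+ e :+ con 1)) refl e ⟩
  suc e ℕ.* (suc e ℕ.+ 1)                          ≡⟨ cong (λ a → a ℕ.* (a ℕ.+ 1)) (ℕ.+-∸-assoc 1 k≤d) ⟨
  (suc d ∸ k) ℕ.* (suc d ∸ k ℕ.+ 1)                ∎
  where
  open ≡-Reasoning
  open +-*-Solver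
  e = d ∸ k
... | no k≰d = begin
  2 ℕ.* ((suc d ∸ k) ℕ.+ triangle k d)             ≡⟨ cong (λ a → 2 ℕ.* (a ℕ.+ triangle k d)) sd∸k≡0 ⟩
  2 ℕ.* triangle k d                               ≡⟨ 2*triangle k d ⟩
  (d ∸ k) ℕ.* (d ∸ k ℕ.+ 1)                        ≡⟨ cong (λ a → a ℕ.* (a ℕ.+ 1)) (ℕ.m≤n⇒m∸n≡0 (ℕ.<⇒≤ (ℕ.≰⇒> k≰d))) ⟩
  0                                                ≡⟨ cong (λ a → a ℕ.* (a ℕ.+ 1)) sd∸k≡0 ⟨
  (suc d ∸ k) ℕ.* (suc d ∸ k ℕ.+ 1)                ∎
  where
  open ≡-Reasoning
  sd∸k≡0 = ℕ.m≤n⇒m∸n≡0 (ℕ.≰⇒> k≰d)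

-- `triangle k d` is 1 + ... + (d - k), half of (d - k)(d - k + 1); since k ≤ d, integer and
-- truncated subtraction agree.
meanExcess-closed : ∀ k d → k ℕ.≤ d →
  ((+ d ℤ.- + k) ℤ.* (+ d ℤ.- + k ℤ.+ + 1)) ℚ./ (2 ℕ.* suc d) ≡ meanExcess k d
meanExcess-closed k d k≤d = ℚ.fromℚᵘ-cong
  -- `mkℚᵘ` takes the predecessor of the denominator, and `2 ℕ.* suc d` computes to
  -- `suc (d ℕ.+ 1 ℕ.* suc d)`.
  {mkℚᵘ ((+ d ℤ.- + k) ℤ.* (+ d ℤ.- + k ℤ.+ + 1)) (d ℕ.+ 1 ℕ.* suc d)} {mkℚᵘ (+ triangle k d) d} (*≡* (begin
  ((+ d ℤ.- + k) ℤ.* (+ d ℤ.- + k ℤ.+ + 1)) ℤ.* + suc d     ≡⟨ cong (λ a → (a ℤ.* (a ℤ.+ + 1)) ℤ.* + suc d)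
                                                                 (trans (ℤ.m-n≡m⊖n d k) (ℤ.⊖-≥ k≤d)) ⟩
  (+ e ℤ.* + (e ℕ.+ 1)) ℤ.* + suc d                         ≡⟨ cong (ℤ._* + suc d) (ℤ.pos-* e (e ℕ.+ 1)) ⟨
  + (e ℕ.* (e ℕ.+ 1)) ℤ.* + suc d                           ≡⟨ cong (λ a → + a ℤ.* + suc d) (2*triangle k d) ⟨
  + (2 ℕ.* triangle k d) ℤ.* + suc d                        ≡⟨ ℤ.pos-* (2 ℕ.* triangle k d) (suc d) ⟨
  + (2 ℕ.* triangle k d ℕ.* suc d)                          ≡⟨ cong +_ (trans (cong (ℕ._* suc d) (ℕ.*-comm 2 (triangle k d)))
                                                                 (ℕ.*-assoc (triangle k d) 2 (suc d))) ⟩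
  + (triangle k d ℕ.* (2 ℕ.* suc d))                        ≡⟨ ℤ.pos-* (triangle k d) (2 ℕ.* suc d) ⟩
  + triangle k d ℤ.* + (2 ℕ.* suc d)                        ∎))
  where
  open ≡-Reasoning
  e = d ∸ k

-- Sums over vertices and lists of all vertices.

seq-∑ : ∀ {n} (f : Fin n → ℝ) t → seq (∑ f) t ≡ ∑ᵖ (allFin n) (λ u _ → seq (f u) t)
seq-∑ f t = go f id (λ u → seq (f u) t) (λ _ → refl)
  where
  go : ∀ {A : Set} {m} (f : Fin m → ℝ) (g : Fin m → A) (h : A → ℚ) → (∀ i → seq (f i) t ≡ h (g i)) →
       seq (∑ f) t ≡ ∑ᵖ (tabulate g) (λ u _ → h u)
  go {m = zero}  f g h eq = refl
  go {m = suc m} f g h eq = cong₂ ℚ._+_ (eq zero) (go (f ∘ suc) (g ∘ suc) h (eq ∘ suc))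

∑ᵖ-↭ : ∀ {A : Set} (h : A → ℚ) {xs ys : List A} → xs ↭ ys → ∑ᵖ xs (λ v _ → h v) ≡ ∑ᵖ ys (λ v _ → h v)
∑ᵖ-↭ h ↭.refl        = refl
∑ᵖ-↭ h (prep x p)    = cong (h x ℚ.+_) (∑ᵖ-↭ h p)
∑ᵖ-↭ h (swap {xs} {ys} x y p) = trans (cong (λ s → h x ℚ.+ (h y ℚ.+ s)) (∑ᵖ-↭ h p))
  (x∙yz≈y∙xz (h x) (h y) (∑ᵖ ys (λ v _ → h v)))
∑ᵖ-↭ h (↭.trans p q) = trans (∑ᵖ-↭ h p) (∑ᵖ-↭ h q)

Unique-resp-↭ : ∀ {A : Set} {xs ys : List A} → xs ↭ ys → Unique xs → Unique ys
Unique-resp-↭ {A} p = ↭ₛ.Unique-resp-↭ (setoid A) (↭⇒↭ₛ p)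

covering⇒↭ : ∀ {n} {us : List (Fin n)} → Unique us → (∀ v → v ∈ us) → us ↭ allFin n
covering⇒↭ {n} unique covers = ∼bag⇒↭ (unique∧set⇒bag unique (allFin⁺ n)
  (λ {v} → mk⇔ (λ _ → ∈-allFin v) (λ _ → covers v)))

-- Orderings as witnesses of degeneracy, and β as the least cost.

module Orderings {n : ℕ} (G : Graph n) (κ : Fin n → ℤ) (k : Fin n → ℕ) (κ≡k : ∀ u → κ u ≡ + k u)
                 (k≤d : ∀ u → k u ℕ.≤ degree G u) where
  open Graph G
  open Averaging G k public

  N-self : ∀ v r → N v (v ∷ r) ≡ N v r
  N-self v r = cong length (filter-reject (adj? v) (irrefl refl))

  N-adj : ∀ {u v} r → Adj u v → N u (v ∷ r) ≡ suc (N u r)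
  N-adj {u} r uv = cong length (filter-accept (adj? u) uv)

  -- Good ι L: the reverse of L witnesses that its entries are (κ + ι)-degenerate.
  data Good (ι : Fin n → ℕ) : List (Fin n) → Set where
    []  : Good ι []
    _∷_ : ∀ {v r} → N v r ℕ.≤ k v ℕ.+ ι v → Good ι r → Good ι (v ∷ r)

  Good-cong : ∀ {ι ι′} L → (∀ u → u ∈ L → ι u ≡ ι′ u) → Good ι L → Good ι′ L
  Good-cong []      eq []      = []
  Good-cong (v ∷ r) eq (p ∷ g) =
    subst (λ i → N v r ℕ.≤ k v ℕ.+ i) (eq v (here refl)) p ∷ Good-cong r (λ u → eq u ∘ there) g

  Good-suffix : ∀ {ι} us {r} → Good ι (us ʳ++ r) → Good ι r
  Good-suffix []       g = g
  Good-suffix (v ∷ us) g with Good-suffix us g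
  ... | _ ∷ g′ = g′

  ≤κ+ι⇒ : ∀ {u m i} → + m ℤ.≤ κ u ℤ.+ + i → m ℕ.≤ k u ℕ.+ i
  ≤κ+ι⇒ {u} le rewrite κ≡k u = ℤ.drop‿+≤+ le

  ⇒≤κ+ι : ∀ {u m i} → m ℕ.≤ k u ℕ.+ i → + m ℤ.≤ κ u ℤ.+ + i
  ⇒≤κ+ι {u} le rewrite κ≡k u = ℤ.+≤+ le

  -- The last condition of `Degenerate` for `us` preceded by the entries of `acc`. The accumulator
  -- lets an induction on `us` move its head to the end of `acc`, whereas the backward list r grows
  -- at the front; only r ↭ acc matters, as `N` ignores order.
  BackBounded : (Fin n → ℕ) → List (Fin n) → List (Fin n) → Set
  BackBounded ι acc us = ∀ (i : Fin (length us)) →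
    N (lookup us i) (acc ++ take (toℕ i) us) ℕ.≤ k (lookup us i) ℕ.+ ι (lookup us i)

  BackBounded⇒Good : ∀ {ι} us {acc r} → r ↭ acc → Good ι r → BackBounded ι acc us → Good ι (us ʳ++ r)
  BackBounded⇒Good []       p g b = g
  BackBounded⇒Good {ι} (v ∷ us) {acc} {r} p g b = BackBounded⇒Good us
    (↭-trans (∷↭∷ʳ v r) (++⁺ʳ [ v ] p))
    (subst (ℕ._≤ k v ℕ.+ ι v) (N-↭ v (↭-trans (↭-reflexive (++-identityʳ acc)) (↭-sym p))) (b zero) ∷ g)
    λ i → subst (λ l → N (lookup us i) l ℕ.≤ k (lookup us i) ℕ.+ ι (lookup us i))
      (sym (++-assoc acc [ v ] (take (toℕ i) us))) (b (suc i))

  Good⇒BackBounded : ∀ {ι} us {acc r} → r ↭ acc → Good ι (us ʳ++ r) → BackBounded ι acc us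
  Good⇒BackBounded {ι} (v ∷ us) {acc} {r} p g zero with Good-suffix us g
  ... | le ∷ _ = subst (ℕ._≤ k v ℕ.+ ι v) (N-↭ v (↭-trans p (↭-reflexive (sym (++-identityʳ acc))))) le
  Good⇒BackBounded {ι} (v ∷ us) {acc} {r} p g (suc i) =
    subst (λ l → N (lookup us i) l ℕ.≤ k (lookup us i) ℕ.+ ι (lookup us i)) (++-assoc acc [ v ] (take (toℕ i) us))
      (Good⇒BackBounded us (↭-trans (∷↭∷ʳ v r) (++⁺ʳ [ v ] p)) g i)

  Degenerate⇒Good : ∀ {ι} → Degenerate G (λ u → κ u ℤ.+ + ι u) ⊤ → ∃ λ L → L ↭ allFin n × Good ι L
  Degenerate⇒Good (us , unique , mem , b) = reverse us
    , ↭-trans (↭-reverse us) (covering⇒↭ unique λ v → Equivalence.from (mem v) ∈⊤)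
    , BackBounded⇒Good us ↭-refl [] (≤κ+ι⇒ ∘ b)

  Good⇒Degenerate : ∀ {ι L} → L ↭ allFin n → Good ι L → Degenerate G (λ u → κ u ℤ.+ + ι u) ⊤
  Good⇒Degenerate {ι} {L} p g = reverse L
    , Unique-resp-↭ (↭-sym q) (allFin⁺ n)
    , (λ v → mk⇔ (λ _ → ∈⊤) (λ _ → ∈-resp-↭ (↭-sym q) (∈-allFin v)))
    , ⇒≤κ+ι ∘ Good⇒BackBounded (reverse L) ↭-refl (subst (Good ι) (sym (reverse-involutive L)) g)
    where
    q : reverse L ↭ allFin n
    q = ↭-trans (↭-reverse L) p

  -- The least ι for which `L` is a witness gives each vertex exactly its excess. One ι has to serve
  -- all weights c, because it is used with the approximations of the real weights at every index.
  realise : ∀ L → Unique L →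
    ∃ λ ι → Good ι L × ∀ c → ∑ᵖ L (λ u _ → c u ℚ.* ⟦ ι u ⟧) ≡ cost c L
  realise []      _ = const 0 , [] , λ _ → refl
  realise (v ∷ r) (v∉r ∷ unique) = let ι , good , total = realise r unique in
    let ι′ = updateAt ι v (const (N v r ∸ k v))
        ι′v = updateAt-updates v {const (N v r ∸ k v)} ι
        ι′u : ∀ u → u ∈ r → ι u ≡ ι′ u
        ι′u u u∈r = sym (updateAt-minimal u v ι (All.lookup v∉r u∈r ∘ sym))
    in ι′
    , subst (λ i → N v r ℕ.≤ k v ℕ.+ i) (sym ι′v) (ℕ.m≤n+m∸n (N v r) (k v)) ∷ Good-cong r ι′u good
    , λ c → cong₂ ℚ._+_ (cong (λ i → c v ℚ.* ⟦ i ⟧) ι′v)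
        (trans (∑ᵖ-cong r λ u s p → cong (λ i → c u ℚ.* ⟦ i ⟧) (sym (ι′u u (∈-resp-↭ p (here refl))))) (total c))

  module _ (c : Fin n → ℝ) where

    c⟨_⟩ : ℕ → Fin n → ℚ
    c⟨ t ⟩ u = seq (c u) t

    bound≋mean : seq (bound G c κ) ≋ meanₛ c⟨_⟩ (allFin n)
    bound≋mean = ≋-reflexive λ t → trans (seq-∑ summand t) (∑ᵖ-cong (allFin n) λ v r p →
      cong (seq (c v) t ℚ.*_) (trans (coefficient v) (cong (meanExcess (k v)) (degree≡ v r p))))
      where
      summand : Fin n → ℝ
      summand u = c u * fromℚ (((+ degree G u ℤ.- κ u) ℤ.* (+ degree G u ℤ.- κ u ℤ.+ + 1))
                               ℚ./ (2 ℕ.* suc (degree G u)))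
      coefficient : ∀ v → ((+ degree G v ℤ.- κ v) ℤ.* (+ degree G v ℤ.- κ v ℤ.+ + 1)) ℚ./ (2 ℕ.* suc (degree G v))
                          ≡ meanExcess (k v) (degree G v)
      coefficient v = trans
        (cong (λ a → ((+ degree G v ℤ.- a) ℤ.* (+ degree G v ℤ.- a ℤ.+ + 1)) ℚ./ (2 ℕ.* suc (degree G v))) (κ≡k v))
        (meanExcess-closed (k v) (degree G v) (k≤d v))
      -- No neighbor of v is lost with v itself, by irreflexivity.
      degree≡ : ∀ v r → v ∷ r ↭ allFin n → degree G v ≡ N v r
      degree≡ v r p = trans (N-↭ v (↭-sym p)) (N-self v r)

    total : (Fin n → ℕ) → ℝ
    total ι = ∑ (λ u → c u * fromℕ (ι u))

    seq-total : ∀ ι {L} → L ↭ allFin n → ∀ t → seq (total ι) t ≡ ∑ᵖ L (λ u _ → c⟨ t ⟩ u ℚ.* ⟦ ι u ⟧)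
    seq-total ι p t = trans (seq-∑ (λ u → c u * fromℕ (ι u)) t) (∑ᵖ-↭ (λ u → c⟨ t ⟩ u ℚ.* ⟦ ι u ⟧) (↭-sym p))

    cost-isCost : ∀ {L} → L ↭ allFin n → ∃ λ ι →
      Degenerate G (λ u → κ u ℤ.+ + ι u) ⊤ × seq (total ι) ≋ costₛ c⟨_⟩ L
    cost-isCost {L} p = let ι , good , eq = realise L (Unique-resp-↭ (↭-sym p) (allFin⁺ n)) in
      ι , Good⇒Degenerate p good , ≋-reflexive λ t → trans (seq-total ι p t) (eq c⟨ t ⟩)

    module _ (c>0 : ∀ u → 0ℝ < c u) where

      0≲c : ∀ u → const 0ℚ ≲ seq (c u)
      0≲c u = let δ , 0<δ , N , p = c>0 u in limit λ ε 0<ε → N , λ t N≤t →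
        ℚ.≤-trans (ℚ.≤-trans (ℚ.<⇒≤ 0<δ) (subst (ℚ._≤ seq (c u) t) (ℚ.+-identityˡ δ) (p t N≤t)))
          (subst (ℚ._≤ seq (c u) t ℚ.+ ε) (ℚ.+-identityʳ (seq (c u) t)) (ℚ.+-monoʳ-≤ (seq (c u) t) (ℚ.<⇒≤ 0<ε)))

      *-monoʳ : ∀ u {i j} → i ℕ.≤ j → (λ t → seq (c u) t ℚ.* ⟦ i ⟧) ≲ (λ t → seq (c u) t ℚ.* ⟦ j ⟧)
      *-monoʳ u {i} {j} i≤j = ≲-trans
        (≲-reflexive λ t → sym (trans (cong (seq (c u) t ℚ.* ⟦ i ⟧ ℚ.+_) (ℚ.*-zeroˡ ⟦ j ∸ i ⟧))
          (ℚ.+-identityʳ (seq (c u) t ℚ.* ⟦ i ⟧))))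
        (≲-trans (≲-+-mono (≲-refl {λ t → seq (c u) t ℚ.* ⟦ i ⟧}) (≲-*⟦⟧ (j ∸ i) (0≲c u)))
          (≲-reflexive λ t → trans (sym (ℚ.*-distribˡ-+ (seq (c u) t) ⟦ i ⟧ ⟦ j ∸ i ⟧))
            (cong (seq (c u) t ℚ.*_) (trans (sym (⟦⟧-+ i (j ∸ i))) (cong ⟦_⟧ (ℕ.m+[n∸m]≡n i≤j))))))

      -- Any ι witnessed by `L` is at least the excess at each vertex, and the weights are
      -- nonnegative. Together with `realise`, this makes β the minimum of the costs of orderings.
      Good⇒cost≲ : ∀ {ι L} → Good ι L → costₛ c⟨_⟩ L ≲ (λ t → ∑ᵖ L (λ u _ → c⟨ t ⟩ u ℚ.* ⟦ ι u ⟧))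
      Good⇒cost≲ []               = ≲-refl
      Good⇒cost≲ {ι} (_∷_ {v} {r} le good) = ≲-+-mono
        (*-monoʳ v (ℕ.m≤n+o⇒m∸n≤o (N v r) (k v) le)) (Good⇒cost≲ good)

      AllCostsAreMean : Set
      AllCostsAreMean = ∀ L → L ↭ allFin n → costₛ c⟨_⟩ L ≋ meanₛ c⟨_⟩ (allFin n)

      -- If the bound is the minimum, no cost lies below the mean, so by `cost≲mean` all costs equal
      -- it. Conversely, the ordering `allFin n` attains the bound, and every ι costs at least as
      -- much as the ordering witnessing it.
      isBeta⇔ : IsBeta G c κ (bound G c κ) ⇔ AllCostsAreMean
      isBeta⇔ = mk⇔ to from
        where
        to : IsBeta G c κ (bound G c κ) → AllCostsAreMean
        to (_ , minimal) L p = cost≲mean c⟨_⟩ (allFin n) lower L p , lower L p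
          where
          lower : ∀ L → L ↭ allFin n → meanₛ c⟨_⟩ (allFin n) ≲ costₛ c⟨_⟩ L
          lower L p = let ι , deg , eq = cost-isCost p in
            ≲-trans (proj₂ bound≋mean) (≲-trans
              (limit (minimal (total ι) (ι , deg , ≋⇒≈ {total ι} {total ι} (≲-refl , ≲-refl)))) (proj₁ eq))
        from : AllCostsAreMean → IsBeta G c κ (bound G c κ)
        from all = (let ι , deg , eq = cost-isCost (↭-refl {x = allFin n}) in
                     ι , deg , ≋⇒≈ {bound G c κ} {total ι}
                       (≋-trans bound≋mean (≋-trans (≋-sym (all _ ↭-refl)) (≋-sym eq))))
          , λ { x (ι , deg , x≈) → let L , p , good = Degenerate⇒Good {ι} deg in
              (≲-trans (proj₁ bound≋mean) (≲-trans (proj₂ (all L p)) (≲-trans (Good⇒cost≲ good)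
                (≲-trans (≲-reflexive λ t → sym (seq-total ι p t)) (proj₂ (≈⇒≋ {x} {total ι} x≈)))))) .eventually }

-- Completing partial orderings, and the increment of the excess.

complete : ∀ {A : Set} {xs L : List A} → Unique xs → All (_∈ L) xs → ∃ λ ys → ys ++ xs ↭ L
complete {xs = []}     {L} _ _ = L , ↭-reflexive (++-identityʳ L)
complete {xs = x ∷ xs} {L} (x∉xs ∷ unique) (x∈L ∷ xs⊆L) =
  let as , bs , eq = ∈-∃++ x∈L
      L↭ = ↭-trans (↭-reflexive eq) (shift x as bs)
      ys , p = complete unique (All.zipWith (λ (x≢y , y∈L) → other x≢y (∈-resp-↭ L↭ y∈L)) (x∉xs , xs⊆L))
  in ys , ↭-trans (shift x ys xs) (↭-trans (prep x p) (↭-sym L↭))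
  where
  other : ∀ {y zs} → x ≢ y → y ∈ x ∷ zs → y ∈ zs
  other x≢y (here refl) = contradiction refl x≢y
  other x≢y (there y∈)  = y∈

-- The indicator of k ≤ m, written as the growth of the excess when one more neighbor precedes.
gain : ℕ → ℕ → ℕ
gain k m = (suc m ∸ k) ∸ (m ∸ k)

gain-∸ : ∀ k m → suc m ∸ k ≡ gain k m ℕ.+ (m ∸ k)
gain-∸ k m = sym (ℕ.m∸n+n≡m (ℕ.∸-monoˡ-≤ k (ℕ.n≤1+n m)))

gain-≤ : ∀ {k m} → k ℕ.≤ m → gain k m ≡ 1
gain-≤ {k} {m} k≤m = trans (cong (_∸ (m ∸ k)) (ℕ.+-∸-assoc 1 k≤m)) (ℕ.m+n∸n≡m 1 (m ∸ k))

gain-> : ∀ {k m} → m ℕ.< k → gain k m ≡ 0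
gain-> {k} {m} m<k = trans (cong (_∸ (m ∸ k)) (ℕ.m≤n⇒m∸n≡0 m<k)) (ℕ.0∸n≡0 (m ∸ k))

positive⇒≴0 : ∀ {x} → 0ℝ < x → ¬ (seq x ≲ const 0ℚ)
positive⇒≴0 {x} (δ , 0<δ , M , p) (limit q) =
  let N , q′ = q (½ ℚ.* δ) (0<½* 0<δ)
      t = M ℕ.⊔ N
      δ≤½δ : 0ℚ ℚ.+ δ ℚ.≤ 0ℚ ℚ.+ ½ ℚ.* δ
      δ≤½δ = ℚ.≤-trans (p t (ℕ.m≤m⊔n M N)) (q′ t (ℕ.m≤n⊔m M N))
  in ℚ.<-irrefl refl (ℚ.<-≤-trans (0<½* 0<δ) (+-cancelˡ-≤ (½ ℚ.* δ)
    (subst₂ ℚ._≤_ (trans (ℚ.+-identityˡ δ) (sym (½+½ δ))) (ℚ.+-comm 0ℚ (½ ℚ.* δ)) δ≤½δ)))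

-- Constant cost and the exchange of consecutive vertices.

module Exchange {n : ℕ} (G : Graph n) (κ : Fin n → ℤ) (k : Fin n → ℕ) (κ≡k : ∀ u → κ u ≡ + k u)
                (k≤d : ∀ u → k u ℕ.≤ degree G u) (c : Fin n → ℝ) (c>0 : ∀ u → 0ℝ < c u) where
  open Graph G
  open Orderings G κ k κ≡k k≤d

  cₛ : ℕ → Fin n → ℚ
  cₛ = c⟨_⟩ c

  Cost : List (Fin n) → Sequence
  Cost = costₛ cₛ

  -- Orderings are listed backwards, so r becomes an initial segment of an ordering of all vertices.
  extend : ∀ {r} → Unique r → ∃ λ ys → ys ++ r ↭ allFin n
  extend unique = complete unique (All.universal ∈-allFin _)

  -- The cost of placing u and v after r when a possible edge between u and v is ignored; this makes
  -- it symmetric in u and v.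
  common : (Fin n → ℚ) → Fin n → Fin n → List (Fin n) → ℚ
  common c u v r = excess c u r ℚ.+ (excess c v r ℚ.+ cost c r)

  common-swap : ∀ c u v r → common c u v r ≡ common c v u r
  common-swap c u v r = x∙yz≈y∙xz (excess c u r) (excess c v r) (cost c r)

  -- Here u comes after v, so v is one further preceding neighbor of u.
  cost-adj : ∀ c {u v} r → Adj u v →
    cost c (u ∷ v ∷ r) ≡ common c u v r ℚ.+ c u ℚ.* ⟦ gain (k u) (N u r) ⟧
  cost-adj c {u} {v} r uv = begin
    c u ℚ.* ⟦ N u (v ∷ r) ∸ k u ⟧ ℚ.+ X
      ≡⟨ cong (λ m → c u ℚ.* ⟦ m ⟧ ℚ.+ X) (trans (cong (_∸ k u) (N-adj r uv)) (gain-∸ (k u) (N u r))) ⟩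
    c u ℚ.* ⟦ g ℕ.+ (N u r ∸ k u) ⟧ ℚ.+ X
      ≡⟨ cong (ℚ._+ X) (trans (cong (c u ℚ.*_) (⟦⟧-+ g (N u r ∸ k u))) (ℚ.*-distribˡ-+ (c u) ⟦ g ⟧ ⟦ N u r ∸ k u ⟧)) ⟩
    (c u ℚ.* ⟦ g ⟧ ℚ.+ excess c u r) ℚ.+ X
      ≡⟨ ℚ.+-assoc (c u ℚ.* ⟦ g ⟧) (excess c u r) X ⟩
    c u ℚ.* ⟦ g ⟧ ℚ.+ (excess c u r ℚ.+ X)
      ≡⟨ ℚ.+-comm (c u ℚ.* ⟦ g ⟧) (excess c u r ℚ.+ X) ⟩
    (excess c u r ℚ.+ X) ℚ.+ c u ℚ.* ⟦ g ⟧ ∎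
    where
    open ≡-Reasoning
    g = gain (k u) (N u r)
    X = excess c v r ℚ.+ cost c r

  cost-nonadj : ∀ c {u v} r → ¬ Adj u v → cost c (u ∷ v ∷ r) ≡ common c u v r
  cost-nonadj c {u} {v} r ¬uv = cong (λ m → c u ℚ.* ⟦ m ∸ k u ⟧ ℚ.+ (excess c v r ℚ.+ cost c r))
    (cong length (filter-reject (adj? u) ¬uv))

  Gain : Fin n → List (Fin n) → Sequence
  Gain u r t = cₛ t u ℚ.* ⟦ gain (k u) (N u r) ⟧

  Exchangeable : Set
  Exchangeable = ∀ {u v} r → Adj u v → Unique (u ∷ v ∷ r) → Gain u r ≋ Gain v r

  -- Each vertex of `ys` is preceded by the same entries on both sides, so its excess cancels.
  Cost-++-cancel : ∀ ys {r s} → r ↭ s → Cost (ys ++ r) ≋ Cost (ys ++ s) → Cost r ≋ Cost s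
  Cost-++-cancel []       p eq = eq
  Cost-++-cancel (y ∷ ys) {r} {s} p eq = Cost-++-cancel ys p (≋-+-cancelˡ (excessₛ cₛ y (ys ++ r))
    (≋-trans eq (≋-reflexive λ t → cong (ℚ._+ Cost (ys ++ s) t) (excess-↭ cₛ y (++⁺ˡ ys (↭-sym p)) t))))

  -- Compare two orderings that start with r, continue with u and v in either order, and then agree.
  -- Their costs are equal; after cancelling the later vertices and `common`, the gain of the second
  -- of the two vertices remains on each side.
  exchangeable : AllCostsAreMean c c>0 → Exchangeable
  exchangeable all {u} {v} r uv unique =
    let ys , p = extend unique
        vur↭ = swap v u ↭-refl
        eq = Cost-++-cancel ys (↭-sym vur↭) (≋-trans (all _ p) (≋-sym (all _ (↭-trans (++⁺ˡ ys vur↭) p))))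
    in ≋-+-cancelˡ (λ t → common (cₛ t) u v r)
      (≋-trans (≋-reflexive λ t → sym (cost-adj (cₛ t) r uv))
        (≋-trans eq (≋-reflexive λ t → trans (cost-adj (cₛ t) r (symm uv))
          (cong (ℚ._+ Gain v r t) (common-swap (cₛ t) v u r)))))

  -- The constructors of `↭` reduce a permutation to exchanges of consecutive entries. Such an
  -- exchange trades one gain for the other if the entries are adjacent, and leaves `common` if they
  -- are not.
  Cost-↭ : Exchangeable → ∀ {r s} → r ↭ s → Unique r → Cost r ≋ Cost s
  Cost-↭ ex ↭.refl unique = ≋-reflexive λ _ → refl
  Cost-↭ ex (prep v p) (_ ∷ unique) = ≋-+-mono (≋-reflexive (excess-↭ cₛ v p)) (Cost-↭ ex p unique)
  Cost-↭ ex (swap {r} {s} u v p) unique@((u≢v ∷ _) ∷ _ ∷ unique′) = ≋-trans (swapped (adj? u v))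
    (≋-+-mono (≋-reflexive (excess-↭ cₛ v (prep u p)))
      (≋-+-mono (≋-reflexive (excess-↭ cₛ u p)) (Cost-↭ ex p unique′)))
    where
    swapped : Dec (Adj u v) → Cost (u ∷ v ∷ r) ≋ Cost (v ∷ u ∷ r)
    swapped (yes uv) = ≋-trans (≋-reflexive λ t → cost-adj (cₛ t) r uv)
      (≋-trans (≋-+-mono (≋-reflexive λ t → common-swap (cₛ t) u v r) (ex r uv unique))
        (≋-reflexive λ t → sym (cost-adj (cₛ t) r (symm uv))))
    swapped (no ¬uv) = ≋-reflexive λ t → trans (cost-nonadj (cₛ t) r ¬uv)
      (trans (common-swap (cₛ t) u v r) (sym (cost-nonadj (cₛ t) r (¬uv ∘ symm))))
  Cost-↭ ex (↭.trans p q) unique = ≋-trans (Cost-↭ ex p unique) (Cost-↭ ex q (Unique-resp-↭ p unique))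

  -- A constant equals its average: `bounded-by-mean` is applied with offset 0 to `≲` and to its
  -- converse.
  exchangeable⇒allMean : Exchangeable → AllCostsAreMean c c>0
  exchangeable⇒allMean ex L p =
      ≲-trans (bounded-by-mean cₛ ≲-isAdditive n′ (allFin n) refl (const 0ℚ) (Cost L)
        λ L′ q → ≲-trans (proj₁ (same L′ q)) (≲-reflexive (λ t → sym (ℚ.+-identityˡ (Cost L′ t)))))
        (≲-reflexive λ t → ℚ.+-identityˡ (meanₛ cₛ (allFin n) t))
    , ≲-trans (≲-reflexive λ t → sym (ℚ.+-identityˡ (meanₛ cₛ (allFin n) t)))
        (bounded-by-mean cₛ ≳-isAdditive n′ (allFin n) refl (const 0ℚ) (Cost L)
          λ L′ q → ≲-trans (≲-reflexive (λ t → ℚ.+-identityˡ (Cost L′ t))) (proj₂ (same L′ q)))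
    where
    n′ = length (allFin n)
    same : ∀ L′ → L′ ↭ allFin n → Cost L ≋ Cost L′
    same L′ q = Cost-↭ ex (↭-trans p (↭-sym q)) (Unique-resp-↭ (↭-sym p) (allFin⁺ n))

  -- Each of the three conditions implies exchangeability.

  N-≤-degree : ∀ u {r} → Unique r → N u r ℕ.≤ degree G u
  N-≤-degree u {r} unique = let ys , p = extend unique in begin
    N u r                                                ≤⟨ ℕ.m≤n+m (N u r) (N u ys) ⟩
    N u ys ℕ.+ N u r                                     ≡⟨ length-++ (filter (adj? u) ys) ⟨
    length (filter (adj? u) ys ++ filter (adj? u) r)     ≡⟨ cong length (filter-++ (adj? u) ys r) ⟨
    N u (ys ++ r)                                        ≡⟨ N-↭ u p ⟩
    degree G u                                           ∎
    where open ℕ.≤-Reasoning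

  Gain-cong : ∀ {u v} r → seq (c u) ≋ seq (c v) → gain (k u) (N u r) ≡ gain (k v) (N v r) → Gain u r ≋ Gain v r
  Gain-cong {u} {v} r (p , q) eq = ≋-trans
    (≲-*⟦⟧ (gain (k u) (N u r)) p , ≲-*⟦⟧ (gain (k u) (N u r)) q)
    (≋-reflexive λ t → cong (λ m → cₛ t v ℚ.* ⟦ m ⟧) eq)

  -- The other end of the edge is a neighbor outside r, so u has fewer than k u neighbors in r; both
  -- gains vanish.
  saturated⇒exchangeable : (∀ u → k u ≡ degree G u) → Exchangeable
  saturated⇒exchangeable k≡d {u} {v} r uv unique@((u≢v ∷ u∉r) ∷ v∉r ∷ unique′) =
    ≋-trans (≋-reflexive (zero-gain u v uv (v∉r ∷ unique′)))
      (≋-sym (≋-reflexive (zero-gain v u (symm uv) (u∉r ∷ unique′))))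
    where
    zero-gain : ∀ u v → Adj u v → Unique (v ∷ r) → ∀ t → Gain u r t ≡ 0ℚ
    zero-gain u v uv unique t = trans (cong (λ m → cₛ t u ℚ.* ⟦ m ⟧) (gain-> (begin
      suc (N u r)   ≡⟨ N-adj r uv ⟨
      N u (v ∷ r)   ≤⟨ N-≤-degree u unique ⟩
      degree G u    ≡⟨ k≡d u ⟨
      k u           ∎))) (ℚ.*-zeroʳ (cₛ t u))
      where open ℕ.≤-Reasoning

  zero⇒exchangeable : (∀ u v → c u ≈ c v) → (∀ u → k u ≡ 0) → Exchangeable
  zero⇒exchangeable c≈c k≡0 {u} {v} r _ _ = Gain-cong r (≈⇒≋ {c u} {c v} (c≈c u v))
    (trans (gain-≤ (subst (ℕ._≤ N u r) (sym (k≡0 u)) z≤n))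
      (sym (gain-≤ (subst (ℕ._≤ N v r) (sym (k≡0 v)) z≤n))))

  -- In a clique u and v are both adjacent to all of r, so their gains agree.
  clique⇒exchangeable : IsClique G → (∀ u v → c u ≈ c v) → (∀ u v → k u ≡ k v) → Exchangeable
  clique⇒exchangeable clique c≈c k≡k {u} {v} r _ ((_ ∷ u∉r) ∷ v∉r ∷ _) =
    Gain-cong r (≈⇒≋ {c u} {c v} (c≈c u v))
      (cong₂ gain (k≡k u v) (trans (N≡length u u∉r) (sym (N≡length v v∉r))))
    where
    N≡length : ∀ u → All (u ≢_) r → N u r ≡ length r
    N≡length u u∉r = cong length (filter-all (adj? u) (All.map (clique u _) u∉r))

  -- Exchangeability forces one of the three conditions.

  Adj⇒≢ : ∀ {u v} → Adj u v → u ≢ v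
  Adj⇒≢ uv refl = irrefl refl uv

  module _ (ex : Exchangeable) where

    -- The gain of u is the positive weight c u, so the gain of v cannot vanish and must be c v.
    tight-transfer : ∀ {u v} r → Adj u v → Unique (u ∷ v ∷ r) → k u ℕ.≤ N u r →
      k v ℕ.≤ N v r × seq (c u) ≋ seq (c v)
    tight-transfer {u} {v} r uv unique ku≤ = decide (k v ℕ.≤? N v r)
      where
      Gain≋c : ∀ u → k u ℕ.≤ N u r → Gain u r ≋ seq (c u)
      Gain≋c u le = ≋-reflexive λ t → trans (cong (λ m → cₛ t u ℚ.* ⟦ m ⟧) (gain-≤ le)) (ℚ.*-identityʳ (cₛ t u))
      eq : seq (c u) ≋ Gain v r
      eq = ≋-trans (≋-sym (Gain≋c u ku≤)) (ex r uv unique)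
      decide : Dec (k v ℕ.≤ N v r) → k v ℕ.≤ N v r × seq (c u) ≋ seq (c v)
      decide (yes kv≤) = kv≤ , ≋-trans eq (Gain≋c v kv≤)
      decide (no  kv≰) = contradiction
        (≲-trans (proj₁ eq) (≲-reflexive λ t →
          trans (cong (λ m → cₛ t v ℚ.* ⟦ m ⟧) (gain-> (ℕ.≰⇒> kv≰))) (ℚ.*-zeroʳ (cₛ t v))))
        (positive⇒≴0 {c u} (c>0 u))

    -- Let r consist of all other vertices: the degrees of u and v are then one more than their
    -- counts in r, and `tight-transfer` applies.
    unsaturated-transfer : ∀ {u v} → Adj u v → k u ℕ.< degree G u →
      k v ℕ.< degree G v × seq (c u) ≋ seq (c v)
    unsaturated-transfer {u} {v} uv k<d =
      let ys , p = extend ((Adj⇒≢ uv ∷ []) ∷ [] ∷ [])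
          uvr↭ = ↭-trans (++-comm (u ∷ v ∷ []) ys) p
          kv≤ , eq = tight-transfer ys uv (Unique-resp-↭ (↭-sym uvr↭) (allFin⁺ n))
            (ℕ.s≤s⁻¹ (subst (k u ℕ.<_) (degree≡ uv uvr↭) k<d))
      in subst (k v ℕ.<_) (sym (degree≡ (symm uv) (↭-trans (swap v u ↭-refl) uvr↭))) (s≤s kv≤) , eq
      where
      degree≡ : ∀ {u v r} → Adj u v → u ∷ v ∷ r ↭ allFin n → degree G u ≡ suc (N u r)
      degree≡ {u} {v} {r} uv p = trans (N-↭ u (↭-sym p)) (trans (N-self u (v ∷ r)) (N-adj r uv))

    -- The first k v neighbours of v other than u form a set on which v is tight, hence so is u.
    neighbours-tight : ∀ {u v s} → Adj v u → k v ℕ.< degree G v →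
      u ∷ s ↭ filter (adj? v) (allFin n) → k u ℕ.≤ N u (take (k v) s)
    neighbours-tight {u} {v} {s} vu k<d p = proj₁ (tight-transfer r vu unique (ℕ.≤-reflexive (sym (begin
      N v r                 ≡⟨ cong length (filter-all (adj? v) adjacent) ⟩
      length r              ≡⟨ length-take (k v) s ⟩
      k v ℕ.⊓ length s      ≡⟨ ℕ.m≤n⇒m⊓n≡m (ℕ.s≤s⁻¹ (subst (k v ℕ.<_) (sym (↭-length p)) k<d)) ⟩
      k v                   ∎))))
      where
      open ≡-Reasoning
      r = take (k v) s
      adjacent : All (Adj v) r
      adjacent = All.take⁺ (k v) (All.tail (All-resp-↭ (↭-sym p) (All.all-filter (adj? v) (allFin n))))
      unique : Unique (v ∷ u ∷ r)
      unique = let unique-us = Unique-resp-↭ (↭-sym p) (filter⁺ (adj? v) (allFin⁺ n)) in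
        (Adj⇒≢ vu ∷ All.map Adj⇒≢ adjacent)
          ∷ All.take⁺ (k v) (AllPairs.head unique-us) ∷ take⁺ (k v) (AllPairs.tail unique-us)

    -- By `neighbours-tight`, u has at least k u neighbors in a list of at most k v vertices.
    k-mono : ∀ {u v} → Adj v u → k v ℕ.< degree G v → k u ℕ.≤ k v
    k-mono {u} {v} vu k<d =
      let ys , p = complete {xs = u ∷ []} ([] ∷ []) (∈-filter⁺ (adj? v) (∈-allFin u) vu ∷ [])
      in begin
        k u                          ≤⟨ neighbours-tight vu k<d (↭-trans (++-comm [ u ] ys) p) ⟩
        N u (take (k v) ys)          ≤⟨ length-filter (adj? u) (take (k v) ys) ⟩
        length (take (k v) ys)       ≡⟨ length-take (k v) ys ⟩
        k v ℕ.⊓ length ys            ≤⟨ ℕ.m⊓n≤m (k v) (length ys) ⟩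
        k v                          ∎
      where open ℕ.≤-Reasoning

    -- Among at most k v neighbors of v, u has at least k u = k v neighbors, so it is adjacent to
    -- all of them.
    adj-trans : ∀ {u v w} → Adj v u → Adj v w → u ≢ w → k v ℕ.< degree G v → 0 ℕ.< k v → k u ≡ k v → Adj u w
    adj-trans {u} {v} {w} vu vw u≢w k<d 0<kv ku≡kv =
      let ys , p = complete {xs = u ∷ w ∷ []} ((u≢w ∷ []) ∷ [] ∷ [])
                     (∈-filter⁺ (adj? v) (∈-allFin u) vu ∷ ∈-filter⁺ (adj? v) (∈-allFin w) vw ∷ [])
          -- Putting w first ensures that it is taken, as k v > 0.
          r = take (k v) (w ∷ ys)
          tight = neighbours-tight vu k<d (↭-trans (++-comm (u ∷ w ∷ []) ys) p)
          full : N u r ≡ length r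
          full = ℕ.≤-antisym (length-filter (adj? u) r) (begin
            length r                       ≡⟨ length-take (k v) (w ∷ ys) ⟩
            k v ℕ.⊓ suc (length ys)        ≤⟨ ℕ.m⊓n≤m (k v) (suc (length ys)) ⟩
            k v                            ≡⟨ ku≡kv ⟨
            k u                            ≤⟨ tight ⟩
            N u r                          ∎)
      in proj₂ (∈-filter⁻ (adj? u) {xs = r} (subst (w ∈_) (sym (filter-complete (adj? u) full)) (first (k v) 0<kv ys)))
      where
      open ℕ.≤-Reasoning
      first : ∀ m → 0 ℕ.< m → ∀ ys → w ∈ take m (w ∷ ys)
      first (suc m) _ ys = here refl

  along : ∀ {P : Fin n → Set} → (∀ {u v} → Adj u v → P u → P v) → ∀ {u v} → Star Adj u v → P u → P v
  along {P} step = fold (λ u v → P u → P v) (λ uv f → f ∘ step uv) id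

  Conclusion : Set
  Conclusion = (∀ u → k u ≡ degree G u)
    ⊎ ((∀ u v → c u ≈ c v) × (∀ u → k u ≡ 0))
    ⊎ (IsClique G × (∀ u v → c u ≈ c v) × (∀ u v → k u ≡ k v) × (∀ u → 0 ℕ.< k u × k u ℕ.< degree G u))

  -- A walk from u to v is shortened edge by edge; it may return to its start, hence the alternative
  -- u ≡ v in the induction.
  transitive⇒clique : Connected G → (∀ {u v w} → Adj v u → Adj v w → u ≢ w → Adj u w) → IsClique G
  transitive⇒clique conn adj-trans u v u≢v =
    fromInj₂ (λ u≡v → contradiction u≡v u≢v) (fold (λ u v → u ≡ v ⊎ Adj u v) join (inj₁ refl) (conn u v))
    where
    join : ∀ {u v w} → Adj u v → v ≡ w ⊎ Adj v w → u ≡ w ⊎ Adj u w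
    join         uv (inj₁ refl) = inj₂ uv
    join {u} {v} {w} uv (inj₂ vw) with u Fin.≟ w
    ... | yes u≡w = inj₁ u≡w
    ... | no  u≢w = inj₂ (adj-trans (symm uv) vw u≢w)

  -- Connectivity spreads k < d and the value of k to all vertices, so testing a single vertex `o`
  -- decides which condition holds.
  exchangeable⇒conclusion : Connected G → Exchangeable → Fin n → Conclusion
  exchangeable⇒conclusion conn ex o = saturated? (k o ℕ.<? degree G o)
    where
    unsaturated : ∀ u v → k u ℕ.< degree G u → k v ℕ.< degree G v
    unsaturated u v = along (λ uv → proj₁ ∘ unsaturated-transfer ex uv) (conn u v)

    saturated? : Dec (k o ℕ.< degree G o) → Conclusion
    saturated? (no k≮d) = inj₁ λ u → ℕ.≤-antisym (k≤d u) (ℕ.≮⇒≥ (k≮d ∘ unsaturated u o))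
    saturated? (yes ko<d) = inj₂ (zero? (k o ℕ.≟ 0))
      where
      k<d : ∀ u → k u ℕ.< degree G u
      k<d u = unsaturated o u ko<d
      c≈c : ∀ u v → c u ≈ c v
      c≈c u v = ≋⇒≈ {c u} {c v} (along {λ w → seq (c u) ≋ seq (c w)}
        (λ {w} wx eq → ≋-trans eq (proj₂ (unsaturated-transfer ex wx (k<d w)))) (conn u v) (≋-reflexive λ _ → refl))
      k≡k : ∀ u v → k u ≡ k v
      -- `k-mono` is used in both directions of each edge.
      k≡k u v = along {λ w → k u ≡ k w} (λ {w} {x} wx eq → trans eq
        (ℕ.≤-antisym (k-mono ex (symm wx) (k<d x)) (k-mono ex wx (k<d w)))) (conn u v) refl
      zero? : Dec (k o ≡ 0) → _
      zero? (yes k≡0) = inj₁ (c≈c , λ u → trans (k≡k u o) k≡0)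
      zero? (no  k≢0) = inj₂
        ( transitive⇒clique conn (λ {u} {v} vu vw u≢w → adj-trans ex vu vw u≢w (k<d v) (0<k v) (k≡k u v))
        , c≈c , k≡k , λ u → 0<k u , k<d u)
        where
        0<k : ∀ u → 0 ℕ.< k u
        0<k u = subst (0 ℕ.<_) (k≡k o u) (ℕ.n≢0⇒n>0 k≢0)

  conclusion⇒exchangeable : Conclusion → Exchangeable
  conclusion⇒exchangeable (inj₁ k≡d)                       = saturated⇒exchangeable k≡d
  conclusion⇒exchangeable (inj₂ (inj₁ (c≈c , k≡0)))        = zero⇒exchangeable c≈c k≡0
  conclusion⇒exchangeable (inj₂ (inj₂ (cl , c≈c , k≡k , _))) = clique⇒exchangeable cl c≈c k≡k

-- The characterisation, by passing between κ and its natural-number values.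

theorem3 : ∀ {n : ℕ} (G : Graph n) → Connected G →
    (c : Fin n → ℝ) → (∀ u → 0ℝ < c u) →
    (κ : Fin n → ℤ) → (∀ u → + 0 ℤ.≤ κ u × κ u ℤ.≤ + degree G u) →
    IsBeta G c κ (bound G c κ)
    ⇔ ( (∀ u → κ u ≡ + degree G u)
    ⊎ ((∀ u v → c u ≈ c v) × (∀ u → κ u ≡ + 0))
    ⊎ ( IsClique G × (∀ u v → c u ≈ c v) × (∀ u v → κ u ≡ κ v)
    × (∀ u → + 0 ℤ.< κ u × κ u ℤ.< + degree G u)))
theorem3 {n} G connected c c>0 κ 0≤κ≤d = mk⇔
  (to ∘ conclude ∘ exchangeable ∘ Equivalence.to (isBeta⇔ c c>0))
  (Equivalence.from (isBeta⇔ c c>0) ∘ exchangeable⇒allMean ∘ conclusion⇒exchangeable ∘ from)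
  where
  k : Fin n → ℕ
  k u = ℤ.∣ κ u ∣
  κ≡k : ∀ u → κ u ≡ + k u
  κ≡k u = sym (ℤ.0≤i⇒+∣i∣≡i (proj₁ (0≤κ≤d u)))
  k≤d : ∀ u → k u ℕ.≤ degree G u
  k≤d u = ℤ.drop‿+≤+ (subst (ℤ._≤ + degree G u) (κ≡k u) (proj₂ (0≤κ≤d u)))
  open Orderings G κ k κ≡k k≤d
  open Exchange G κ k κ≡k k≤d c c>0

  conclude : Exchangeable → Conclusion
  conclude = byOrder n refl
    where
    byOrder : ∀ m → m ≡ n → Exchangeable → Conclusion
    -- The empty graph has no vertex to test, and condition (i) holds vacuously.
    byOrder zero    refl _  = inj₁ λ ()
    byOrder (suc _) refl ex = exchangeable⇒conclusion connected ex zero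

  to : Conclusion → _
  to = Sum.map (λ k≡d u → trans (κ≡k u) (cong +_ (k≡d u)))
    (Sum.map (λ (c≈c , k≡0) → c≈c , λ u → trans (κ≡k u) (cong +_ (k≡0 u)))
      (λ (clique , c≈c , k≡k , 0<k<d) → clique , c≈c
        , (λ u v → trans (κ≡k u) (trans (cong +_ (k≡k u v)) (sym (κ≡k v))))
        , λ u → subst (+ 0 ℤ.<_) (sym (κ≡k u)) (ℤ.+<+ (proj₁ (0<k<d u)))
              , subst (ℤ._< + degree G u) (sym (κ≡k u)) (ℤ.+<+ (proj₂ (0<k<d u)))))

  from : _ → Conclusion
  from = Sum.map (λ κ≡d u → cong ℤ.∣_∣ (κ≡d u))
    (Sum.map (λ (c≈c , κ≡0) → c≈c , λ u → cong ℤ.∣_∣ (κ≡0 u))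
      (λ (clique , c≈c , κ≡κ , 0<κ<d) → clique , c≈c , (λ u v → cong ℤ.∣_∣ (κ≡κ u v))
        , λ u → ℤ.drop‿+<+ (subst (+ 0 ℤ.<_) (κ≡k u) (proj₁ (0<κ<d u)))
              , ℤ.drop‿+<+ (subst (ℤ._< + degree G u) (κ≡k u) (proj₂ (0<κ<d u)))))
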